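{- Let $q$ be a prime power and $m,n$ positive integers with $\max\{m,n\}>1$. Then $$|\mathrm{TSRI}(1,n;q)|=|\mathcal{I}(n;q)|,\qquad |\mathrm{TSRI}(m,1;q)|=\frac{|\operatorname{GL}_m(\mathbb{F}_q)|}{q^m-1}|\mathcal{I}(m;q)|,$$ $$|\mathrm{TSRP}(1,n;q)|=|\mathcal{P}(n;q)|,\qquad |\mathrm{TSRP}(m,1;q)|=\frac{|\operatorname{GL}_m(\mathbb{F}_q)|}{q^m-1}|\mathcal{P}(m;q)|.$$
   Context: An $(m,n)$-TSR matrix over $\mathbb{F}_q$ is a matrix $T\in \operatorname{M}_{mn}(\mathbb{F}_q)$ which, viewed as an $n\times n$ array of $m\times m$ blocks, has $I_m$ in block positions $(i+1,i)$ for $1\le i\le n-1$, has last block column $(c_0B,\dots,c_{n-1}B)^{T}$ (top to bottom) for some $c_i\in\mathbb{F}_q$ and $B\in \operatorname{M}_m(\mathbb{F}_q)$, and all other blocks zero. $\mathrm{TSRI}(m,n;q)$ (resp. $\mathrm{TSRP}(m,n;q)$) is the set of such matrices whose characteristic polynomial is irreducible (resp. primitive) over $\mathbb{F}_q$. $\mathcal{I}(r;q)$ and $\mathcal{P}(r;q)$ denote the sets of monic irreducible, resp. primitive, polynomials of degree $r$ in $\mathbb{F}_q[X]$. -}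

module Defs where

open import Level using (0ℓ)
open import Data.Nat as ℕ using (ℕ; zero; suc; _∸_; _^_; _≤_; _<_)
open import Data.Fin as Fin using (Fin; toℕ; remQuot)
open import Data.List as List using (List; []; _∷_; length; replicate; _++_)
open import Data.List.Relation.Unary.Unique.Propositional using (Unique)
open import Data.List.Membership.Propositional using (_∈_)
open import Data.Vec as Vec using (Vec; []; _∷_; tabulate; lookup; removeAt; toList; foldr)
open import Data.Product using (Σ; ∃; ∃₂; _×_; _,_; proj₁; proj₂)
open import Data.Sum using (_⊎_)
open import Data.Bool using (Bool; true; false; if_then_else_)
open import Relation.Nullary using (¬_; Dec; does)
open import Relation.Binary.PropositionalEquality using (_≡_; _≢_)
open import Relation.Binary.Definitions using (DecidableEquality)
open import Algebra.Structures using (IsCommutativeRing)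
open import Function.Bundles using (_⇔_)

HasCard : {A : Set} → (A → Set) → ℕ → Set
HasCard {A} P k =
  Σ (List A) λ xs → Unique xs × length xs ≡ k × (∀ x → (x ∈ xs) ⇔ P x)

record FiniteField (q : ℕ) : Set₁ where
  infixl 6 _+_
  infixl 7 _*_
  field
    Carrier  : Set
    _≟_      : DecidableEquality Carrier
    _+_ _*_  : Carrier → Carrier → Carrier
    -_       : Carrier → Carrier
    0# 1#    : Carrier
    isCommutativeRing : IsCommutativeRing _≡_ _+_ _*_ -_ 0# 1#
    0≢1      : 0# ≢ 1#
    inverse  : ∀ x → x ≢ 0# → ∃ λ y → x * y ≡ 1#
    elements : List Carrier
    elements-unique   : Unique elements
    elements-complete : ∀ x → x ∈ elements
    elements-length   : length elements ≡ q

module FF {q : ℕ} (F : FiniteField q) where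
  open FiniteField F

  -- Polynomials over F: coefficient lists, constant term first.
  Poly : Set
  Poly = List Carrier

  infixl 6 _+P_
  infixl 7 _*P_

  _+P_ : Poly → Poly → Poly
  [] +P g = g
  (a ∷ f) +P [] = a ∷ f
  (a ∷ f) +P (b ∷ g) = (a + b) ∷ (f +P g)

  negP : Poly → Poly
  negP = List.map -_

  scaleP : Carrier → Poly → Poly
  scaleP a = List.map (a *_)

  _*P_ : Poly → Poly → Poly
  [] *P g = []
  (a ∷ f) *P g = scaleP a g +P (0# ∷ (f *P g))

  oneP : Poly
  oneP = 1# ∷ []

  normalize : Poly → Poly
  normalize [] = []
  normalize (a ∷ f) with normalize f
  ... | b ∷ g = a ∷ b ∷ g
  ... | [] = if does (a ≟ 0#) then [] else a ∷ []

  _≈P_ : Poly → Poly → Set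
  f ≈P g = normalize f ≡ normalize g

  -- degree (the zero polynomial is given degree 0; irrelevant below)
  deg : Poly → ℕ
  deg f = length (normalize f) ∸ 1

  _∣P_ : Poly → Poly → Set
  f ∣P g = ∃ λ h → (f *P h) ≈P g

  XpowMinus1 : ℕ → Poly
  XpowMinus1 e = (- 1# ∷ []) +P (replicate e 0# ++ (1# ∷ []))

  monicPoly : ∀ {r} → Vec Carrier r → Poly
  monicPoly cs = toList cs ++ (1# ∷ [])

  Irreducible : Poly → Set
  Irreducible f = (1 ≤ deg f) ×
    (∀ g h → (g *P h) ≈P f → deg g ≡ 0 ⊎ deg h ≡ 0)

  -- primitive (of degree r = deg f): irreducible of order q^r - 1,
  -- i.e. f ∣ X^(q^r-1) - 1 and f ∤ X^e - 1 for 1 ≤ e < q^r - 1.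
  Primitive : Poly → Set
  Primitive f = Irreducible f ×
    (f ∣P XpowMinus1 (q ^ deg f ∸ 1)) ×
    (∀ e → 1 ≤ e → e < q ^ deg f ∸ 1 → ¬ (f ∣P XpowMinus1 e))

  𝓘 : (r : ℕ) → Vec Carrier r → Set
  𝓘 r cs = Irreducible (monicPoly cs)

  𝓟 : (r : ℕ) → Vec Carrier r → Set
  𝓟 r cs = Primitive (monicPoly cs)

  Mat : ℕ → Set
  Mat k = Vec (Vec Carrier k) k

  entry : ∀ {k} → Mat k → Fin k → Fin k → Carrier
  entry M i j = lookup (lookup M i) j

  sumF : ∀ {k} → Vec Carrier k → Carrier
  sumF = foldr _ _+_ 0#

  idM : ∀ {k} → Mat k
  idM = tabulate λ i → tabulate λ j → if does (i Fin.≟ j) then 1# else 0#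

  _*M_ : ∀ {k} → Mat k → Mat k → Mat k
  M *M N = tabulate λ i → tabulate λ l → sumF (tabulate λ j → entry M i j * entry N j l)

  GL : (k : ℕ) → Mat k → Set
  GL k M = ∃ λ N → (M *M N ≡ idM) × (N *M M ≡ idM)

  sumP : ∀ {k} → Vec Poly k → Poly
  sumP = foldr _ _+P_ []

  alt : ℕ → Poly → Poly
  alt zero f = f
  alt (suc n) f = negP (alt n f)

  detP : ∀ {k} → Vec (Vec Poly k) k → Poly
  detP {zero} [] = oneP
  detP {suc k} (row ∷ rows) =
    sumP (tabulate λ j → alt (toℕ j)
      (lookup row j *P detP (Vec.map (λ r → removeAt r j) rows)))

  charPoly : ∀ {k} → Mat k → Poly
  charPoly {k} T = detP (tabulate λ i → tabulate λ j →
    if does (i Fin.≟ j) then (- entry T i j) ∷ 1# ∷ [] else (- entry T i j) ∷ [])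

  -- (m,n)-TSR matrices: size n*m, an n×n array of m×m blocks.
  -- Row index i ↦ (block a : Fin n, inner row r : Fin m).

  tsr : (m n : ℕ) → Vec Carrier n → Mat m → Mat (n ℕ.* m)
  tsr m n c B = tabulate λ i → tabulate λ j →
    let a = proj₁ (remQuot {n} m i) ; r = proj₂ (remQuot {n} m i)
        b = proj₁ (remQuot {n} m j) ; s = proj₂ (remQuot {n} m j)
    in if does (suc (toℕ b) ℕ.≟ n)
         then lookup c a * entry B r s
         else (if does (toℕ a ℕ.≟ suc (toℕ b))
                 then (if does (r Fin.≟ s) then 1# else 0#)
                 else 0#)

  IsTSR : (m n : ℕ) → Mat (n ℕ.* m) → Set
  IsTSR m n T = ∃₂ λ c B → T ≡ tsr m n c B

  TSRI : (m n : ℕ) → Mat (n ℕ.* m) → Set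
  TSRI m n T = IsTSR m n T × Irreducible (charPoly T)

  TSRP : (m n : ℕ) → Mat (n ℕ.* m) → Set
  TSRP m n T = IsTSR m n T × Primitive (charPoly T)

module Submission where

-- A (1,n)-TSR matrix is a companion matrix, and an (m,1)-TSR matrix is an arbitrary m × m matrix T.
-- In the second case, count the pairs (T , w) with w ≠ 0 a row vector and f = χ(T) irreducible
-- (resp. primitive): by Cayley–Hamilton the annihilator of w is generated by f, so
-- w, wT, …, wT^(m-1) are the rows of an invertible matrix P, with P T = C P for the companion
-- matrix C of f.  Conversely P and f determine T = P⁻¹ C P and w, the first row of P; hence the
-- pairs are in bijection with GL_m × 𝓘(m) (resp. GL_m × 𝓟(m)).
-- Neither multiplicativity of the determinant nor similarity invariance of χ is needed: a monic
-- polynomial of degree m that annihilates a cyclic vector is unique, so Cayley–Hamilton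
-- identifies χ(T).

open import Defs
open import Level using (0ℓ)
open import Algebra.Bundles using (CommutativeRing; AbelianGroup)
open import Algebra.Structures using (IsCommutativeRing)
open import Data.Bool using (true; false; if_then_else_)
open import Data.Fin as Fin using (Fin; zero; suc; toℕ; fromℕ; inject₁; punchIn; punchOut; remQuot; combine)
import Data.Fin.Properties as Fin
open import Data.Fin.Relation.Unary.Top using (view; ‵fromℕ; ‵inject₁)
open import Data.List as List using (List; []; _∷_; length; map; filter; cartesianProductWith; cartesianProduct)
import Data.List.Properties as List
open import Data.List.Membership.Propositional using (_∈_; lose)
open import Data.List.Membership.Propositional.Properties
open import Data.List.Relation.Unary.All as All using ()
open import Data.List.Relation.Unary.All.Properties using (¬Any⇒All¬; All¬⇒¬Any)
open import Data.List.Relation.Unary.AllPairs using ([]; _∷_)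
open import Data.List.Relation.Unary.Any as Any using (here; there)
open import Data.List.Relation.Unary.Unique.Propositional using (Unique)
import Data.List.Relation.Unary.Unique.Propositional.Properties as Unique
open import Data.Nat as ℕ using (ℕ; zero; suc; s≤s; s≤s⁻¹; z≤n)
import Data.Nat.Properties as ℕ
open import Data.Product using (∃; _×_; _,_; proj₁; proj₂)
open import Data.Sum as Sum using (_⊎_; inj₁; inj₂)
open import Data.Unit using (⊤; tt)
open import Data.Vec as Vec using (Vec; []; _∷_; toList; tabulate; lookup; removeAt)
import Data.Vec.Properties as Vec
open import Function using (_∘_)
open import Function.Bundles using (_⇔_; mk⇔; Equivalence)
open import Relation.Binary.Definitions using (DecidableEquality; tri<; tri≈; tri>)
open import Relation.Binary.PropositionalEquality
  using (_≡_; _≢_; refl; sym; trans; cong; cong₂; subst; subst₂; module ≡-Reasoning)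
open import Relation.Nullary using (¬_; Dec; yes; no; does; contradiction; ¬?)
open import Relation.Nullary.Decidable as Dec using (dec-true; dec-false; _×-dec_; _⊎-dec_; _→-dec_)
open import Relation.Unary using (Decidable)

-- `HasCard` asks for explicit duplicate-free lists, while `Irreducible` and `Primitive` quantify
-- over all polynomials; both are therefore decided first, by searches that degree bounds make
-- finite. Why w, wT, ... are independent: a nonzero polynomial g of degree below m that kills w may
-- be taken monic. The remainder of f modulo g kills w as well and has smaller degree, so it is zero
-- by induction, and g divides f against irreducibility. Independent rows then give an invertible
-- matrix by pigeonhole on the finite set of row vectors. Cayley-Hamilton treats row vectors as a
-- module over F[X] with X acting as T. The unit vectors solve the homogeneous system with matrix X
-- I - T, so multiplying by the adjugate shows that the determinant kills each of them. The
-- determinant is developed over any commutative ring up to its own equality, because lists of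
-- coefficients represent polynomials only up to trailing zeros. Vectors are rows, but a companion
-- matrix of TSR shape carries its coefficients in the last column. The relation between P and T is
-- hence written with the transposed companion matrix.

-- Finite cardinalities and the pigeonhole principle

module Cardinalities where
  private variable
    A B C : Set
    P Q : A → Set

  remove-∈ : ∀ {x : A} {ys} → x ∈ ys →
    ∃ λ zs → length ys ≡ suc (length zs) × (∀ {y} → y ∈ ys → y ≢ x → y ∈ zs)
  remove-∈ {ys = y ∷ ys} (here refl) = ys , refl , λ where
    (here y≡x)  y≢x → contradiction y≡x y≢x
    (there y∈) _   → y∈
  remove-∈ {ys = y ∷ ys} (there x∈ys) with zs , eq , incl ← remove-∈ x∈ys =
    y ∷ zs , cong suc eq , λ where
      (here y≡)  _   → here y≡
      (there y∈) y≢x → there (incl y∈ y≢x)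

  -- Delete the head of `xs` from `ys`; uniqueness keeps the tail of `xs` inside what remains.
  unique-⊆⇒≤ : ∀ {xs ys : List A} → Unique xs → (∀ {x} → x ∈ xs → x ∈ ys) → length xs ℕ.≤ length ys
  unique-⊆⇒≤ {xs = []}     _          _   = z≤n
  unique-⊆⇒≤ {xs = x ∷ xs} (x∉ ∷ xs!) sub with zs , eq , incl ← remove-∈ (sub (here refl)) =
    subst (suc (length xs) ℕ.≤_) (sym eq) (s≤s (unique-⊆⇒≤ xs! λ y∈ →
      incl (sub (there y∈)) λ y≡x → All¬⇒¬Any x∉ (subst (_∈ xs) y≡x y∈)))

  -- Pigeonhole: an element `y` of `ys` missing from `xs` would make `y ∷ xs` a duplicate-free list
  -- inside `ys` that is too long.
  unique-⊆⇒⊇ : DecidableEquality A → ∀ {xs ys : List A} → Unique xs →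
    (∀ {x} → x ∈ xs → x ∈ ys) → length ys ℕ.≤ length xs → ∀ {y} → y ∈ ys → y ∈ xs
  unique-⊆⇒⊇ _≟_ {xs} {ys} xs! sub ys≤xs {y} y∈ys with Any.any? (y ≟_) xs
  ... | yes y∈xs = y∈xs
  ... | no  y∉xs = contradiction
    (ℕ.≤-trans (unique-⊆⇒≤ {xs = y ∷ xs} (¬Any⇒All¬ xs y∉xs ∷ xs!)
      λ { (here refl) → y∈ys ; (there x∈) → sub x∈ }) ys≤xs) ℕ.1+n≰n

  map-unique : (f : A → B) {xs : List A} → (∀ {x y} → x ∈ xs → y ∈ xs → f x ≡ f y → x ≡ y) →
    Unique xs → Unique (map f xs)
  map-unique f {[]}     inj []         = []
  map-unique f {x ∷ xs} inj (x∉ ∷ xs!) =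
    ¬Any⇒All¬ _ (λ fx∈ → let y , y∈ , fx≡fy = ∈-map⁻ f fx∈ in
      All¬⇒¬Any x∉ (subst (_∈ xs) (sym (inj (here refl) (there y∈) fx≡fy)) y∈))
    ∷ map-unique f (λ x∈ y∈ → inj (there x∈) (there y∈)) xs!

  -- Double counting rests on this: two enumerations of one set, obtained in different ways, give an
  -- equation between numbers.
  hasCard-unique : ∀ {a b} → HasCard P a → HasCard P b → a ≡ b
  hasCard-unique (xs , xs! , refl , xs⇔) (ys , ys! , refl , ys⇔) = ℕ.≤-antisym
    (unique-⊆⇒≤ xs! (Equivalence.from (ys⇔ _) ∘ Equivalence.to (xs⇔ _)))
    (unique-⊆⇒≤ ys! (Equivalence.from (xs⇔ _) ∘ Equivalence.to (ys⇔ _)))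

  hasCard-cong : ∀ {a} → (∀ x → P x ⇔ Q x) → HasCard P a → HasCard Q a
  hasCard-cong P⇔Q (xs , xs! , len , xs⇔) = xs , xs! , len , λ x →
    mk⇔ (Equivalence.to (P⇔Q x) ∘ Equivalence.to (xs⇔ x))
        (Equivalence.from (xs⇔ x) ∘ Equivalence.from (P⇔Q x))

  -- Injectivity is asked only on `P`: the Krylov map to which this is applied forgets the matrix
  -- when the vector is zero.
  hasCard-map : ∀ {a} {P : A → Set} {Q : B → Set} (f : A → B) → (∀ {x} → P x → Q (f x)) →
    (∀ {x y} → P x → P y → f x ≡ f y → x ≡ y) →
    (∀ {y} → Q y → ∃ λ x → P x × f x ≡ y) →
    HasCard P a → HasCard Q a
  hasCard-map {Q = Q} f pres inj surj (xs , xs! , len , xs⇔) =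
    map f xs ,
    map-unique f (λ x∈ y∈ → inj (Equivalence.to (xs⇔ _) x∈) (Equivalence.to (xs⇔ _) y∈)) xs! ,
    trans (List.length-map f xs) len ,
    λ y → mk⇔
      (λ y∈ → let x , x∈ , y≡ = ∈-map⁻ f y∈ in subst Q (sym y≡) (pres (Equivalence.to (xs⇔ x) x∈)))
      (λ Qy → let x , Px , fx≡y = surj Qy in
        subst (_∈ map f xs) fx≡y (∈-map⁺ f (Equivalence.from (xs⇔ x) Px)))

  cartesianProductWith-length : (f : A → B → C) (xs : List A) (ys : List B) →
    length (cartesianProductWith f xs ys) ≡ length xs ℕ.* length ys
  cartesianProductWith-length f []       ys = refl
  cartesianProductWith-length f (x ∷ xs) ys = trans (List.length-++ (map (f x) ys))
    (cong₂ ℕ._+_ (List.length-map (f x) ys) (cartesianProductWith-length f xs ys))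

  hasCard-× : ∀ {a b} {P : A → Set} {Q : B → Set} → HasCard P a → HasCard Q b →
    HasCard (λ ((x , y) : A × B) → P x × Q y) (a ℕ.* b)
  hasCard-× (xs , xs! , refl , xs⇔) (ys , ys! , refl , ys⇔) =
    cartesianProduct xs ys ,
    Unique.cartesianProduct⁺ xs! ys! ,
    cartesianProductWith-length _,_ xs ys ,
    λ _ → mk⇔
      (λ xy∈ → let x∈ , y∈ = ∈-cartesianProduct⁻ xs ys xy∈ in
        Equivalence.to (xs⇔ _) x∈ , Equivalence.to (ys⇔ _) y∈)
      (λ (Px , Qy) → ∈-cartesianProduct⁺ (Equivalence.from (xs⇔ _) Px) (Equivalence.from (ys⇔ _) Qy))

  Finite : (A : Set) → ℕ → Set
  Finite A = HasCard {A} (λ _ → ⊤)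

  finite-vec : ∀ {q} → Finite A q → ∀ n → Finite (Vec A n) (q ℕ.^ n)
  finite-vec fin zero = [] ∷ [] , All.[] ∷ [] , refl , λ { [] → mk⇔ _ λ _ → here refl }
  finite-vec (xs , xs! , refl , xs⇔) (suc n)
    with vs , vs! , len , vs⇔ ← finite-vec (xs , xs! , refl , xs⇔) n =
    cartesianProductWith _∷_ xs vs ,
    Unique.cartesianProductWith⁺ _∷_ Vec.∷-injective xs! vs! ,
    trans (cartesianProductWith-length _∷_ xs vs) (cong (length xs ℕ.*_) len) ,
    λ { (x ∷ v) → mk⇔ _ λ _ →
      ∈-cartesianProductWith⁺ _∷_ (Equivalence.from (xs⇔ x) tt) (Equivalence.from (vs⇔ v) tt) }

  module _ {n} (fin : Finite A n) where
    private
      xs = proj₁ fin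
      ∈xs : ∀ x → x ∈ xs
      ∈xs x = Equivalence.from (proj₂ (proj₂ (proj₂ fin)) x) tt

    ∃? : {P : A → Set} → Decidable P → Dec (∃ P)
    ∃? P? = Dec.map′ Any.satisfied (λ (x , Px) → lose (∈xs x) Px) (Any.any? P? xs)

    ∀? : {P : A → Set} → Decidable P → Dec (∀ x → P x)
    ∀? P? = Dec.map′ (λ all x → All.lookup all (∈xs x)) (λ all → All.universal all xs) (All.all? P? xs)

    -- The cardinality is whatever the filtered enumeration yields; no formula for it is ever
    -- computed.
    decidable-hasCard : {P : A → Set} → Decidable P → ∃ (HasCard P)
    decidable-hasCard P? = _ , filter P? xs , Unique.filter⁺ P? (proj₁ (proj₂ fin)) , refl ,
      λ x → mk⇔ (proj₂ ∘ ∈-filter⁻ P? {xs = xs}) (∈-filter⁺ P? (∈xs x))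

    -- The images of the enumeration form a duplicate-free list of full length, which must contain
    -- every element.
    injective⇒surjective : DecidableEquality A → (f : A → A) → (∀ {x y} → f x ≡ f y → x ≡ y) →
      ∀ y → ∃ λ x → f x ≡ y
    injective⇒surjective _≟_ f inj y =
      let x , _ , y≡ = ∈-map⁻ f (unique-⊆⇒⊇ _≟_ {map f xs} {xs} (Unique.map⁺ inj (proj₁ (proj₂ fin)))
            (λ _ → ∈xs _) (ℕ.≤-reflexive (sym (List.length-map f xs))) (∈xs y))
      in x , sym y≡

    -- Putting `x` in front of the enumeration of the other elements enumerates everything. With `x`
    -- the zero vector this is the source of the factor q^m - 1.
    hasCard-≢ : DecidableEquality A → (x : A) → HasCard (_≢ x) (n ℕ.∸ 1)
    hasCard-≢ _≟_ x with decidable-hasCard (λ y → ¬? (y ≟ x))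
    ... | k , ys , ys! , len , ys⇔ = subst (HasCard (_≢ x)) (cong (ℕ._∸ 1) 1+k≡n) (ys , ys! , len , ys⇔)
      where
      1+k≡n : suc k ≡ n
      1+k≡n = hasCard-unique
        (x ∷ ys , ¬Any⇒All¬ ys (λ x∈ → Equivalence.to (ys⇔ x) x∈ refl) ∷ ys! , cong suc len ,
          λ y → mk⇔ _ λ _ → case-∈ y (y ≟ x))
        fin
        where
        case-∈ : ∀ y → Dec (y ≡ x) → y ∈ x ∷ ys
        case-∈ y (yes y≡x) = here y≡x
        case-∈ y (no  y≢x) = there (Equivalence.from (ys⇔ y) y≢x)

open Cardinalities

-- Determinants

module Determinant (R : CommutativeRing 0ℓ 0ℓ) where
  open CommutativeRing R hiding (zero) renaming (refl to ≈-refl; sym to ≈-sym; trans to ≈-trans)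
  open import Algebra.Properties.Ring ring using (-0#≈0#; -‿+-comm; -‿distribʳ-*)
  open import Algebra.Properties.Semiring.Sum semiring
  import Algebra.Properties.CommutativeSemigroup +-commutativeSemigroup as +
  import Algebra.Properties.CommutativeSemigroup *-commutativeSemigroup as *
  open import Relation.Binary.Reasoning.Setoid setoid

  Matrix : ℕ → Set
  Matrix n = Fin n → Fin n → Carrier

  signed : ℕ → Carrier → Carrier
  signed zero    x = x
  signed (suc n) x = - signed n x

  minor : ∀ {n} → Matrix (suc n) → Fin (suc n) → Matrix n
  minor A j r c = A (suc r) (punchIn j c)

  -- The same expansion along the first row as `detP`, but on functions, where replacing a column is
  -- a mere conditional.
  det : ∀ {n} → Matrix n → Carrier
  det {zero}  A = 1#
  det {suc n} A = sum λ j → signed (toℕ j) (A zero j * det (minor A j))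

  signed-cong : ∀ n {x y} → x ≈ y → signed n x ≈ signed n y
  signed-cong zero    x≈y = x≈y
  signed-cong (suc n) x≈y = -‿cong (signed-cong n x≈y)

  signed-0 : ∀ n {x} → x ≈ 0# → signed n x ≈ 0#
  signed-0 zero    x≈0 = x≈0
  signed-0 (suc n) x≈0 = ≈-trans (-‿cong (signed-0 n x≈0)) -0#≈0#

  signed-linear : ∀ n x y a b → signed n (x * a + y * b) ≈ x * signed n a + y * signed n b
  signed-linear zero    x y a b = ≈-refl
  signed-linear (suc n) x y a b = begin
    - signed n (x * a + y * b)                ≈⟨ -‿cong (signed-linear n x y a b) ⟩
    - (x * signed n a + y * signed n b)       ≈⟨ -‿+-comm _ _ ⟨
    - (x * signed n a) + - (y * signed n b)   ≈⟨ +-cong (-‿distribʳ-* _ _) (-‿distribʳ-* _ _) ⟩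
    x * - signed n a + y * - signed n b       ∎

  det-cong : ∀ {n} {A B : Matrix n} → (∀ r c → A r c ≈ B r c) → det A ≈ det B
  det-cong {zero}  A≈B = ≈-refl
  det-cong {suc n} A≈B = sum-cong-≋ λ j →
    signed-cong (toℕ j) (*-cong (A≈B zero j) (det-cong λ r c → A≈B (suc r) (punchIn j c)))

  sum-linear : ∀ {n} x y (f g : Fin n → Carrier) →
    sum (λ i → x * f i + y * g i) ≈ x * sum f + y * sum g
  sum-linear x y f g = ≈-trans (∑-distrib-+ (λ i → x * f i) (λ i → y * g i))
    (+-cong (≈-sym (*-distribˡ-sum x f)) (≈-sym (*-distribˡ-sum y g)))

  -- In the expansion along the first row, the term at `j` has a linear entry and a common minor.
  -- Every other term has a common entry and a minor that is linear in its column `punchOut l≢j`, by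
  -- induction.
  det-linear : ∀ {n} {A B C : Matrix n} j x y →
    (∀ r c → c ≢ j → C r c ≈ A r c × C r c ≈ B r c) →
    (∀ r → C r j ≈ x * A r j + y * B r j) →
    det C ≈ x * det A + y * det B
  det-linear {suc n} {A} {B} {C} j x y off at =
    ≈-trans (sum-cong-≋ term) (sum-linear x y (λ l → signed (toℕ l) (A zero l * det (minor A l)))
                                                 (λ l → signed (toℕ l) (B zero l * det (minor B l))))
    where
    term : ∀ l → signed (toℕ l) (C zero l * det (minor C l)) ≈
      x * signed (toℕ l) (A zero l * det (minor A l)) + y * signed (toℕ l) (B zero l * det (minor B l))
    term l with l Fin.≟ j
    ... | yes refl = ≈-trans (signed-cong (toℕ j) (begin
      C zero j * det (minor C j)
        ≈⟨ *-congʳ (at zero) ⟩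
      (x * A zero j + y * B zero j) * det (minor C j)
        ≈⟨ distribʳ _ _ _ ⟩
      x * A zero j * det (minor C j) + y * B zero j * det (minor C j)
        ≈⟨ +-cong (*-assoc _ _ _) (*-assoc _ _ _) ⟩
      x * (A zero j * det (minor C j)) + y * (B zero j * det (minor C j))
        ≈⟨ +-cong (*-congˡ (*-congˡ (det-cong λ r c → proj₁ (off (suc r) _ (Fin.punchInᵢ≢i j c)))))
                  (*-congˡ (*-congˡ (det-cong λ r c → proj₂ (off (suc r) _ (Fin.punchInᵢ≢i j c))))) ⟩
      x * (A zero j * det (minor A j)) + y * (B zero j * det (minor B j)) ∎))
      (signed-linear (toℕ j) x y _ _)
    ... | no l≢j = ≈-trans (signed-cong (toℕ l) (begin
      C zero l * det (minor C l)
        ≈⟨ *-congˡ (det-linear {A = minor A l} {minor B l} {minor C l} (punchOut l≢j) x y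
             (λ r c c≢ → off (suc r) _ λ eq → c≢ (Fin.punchIn-injective l _ _ (trans eq (sym back))))
             (λ r → subst (λ c → C (suc r) c ≈ x * A (suc r) c + y * B (suc r) c) (sym back) (at (suc r)))) ⟩
      C zero l * (x * det (minor A l) + y * det (minor B l))
        ≈⟨ distribˡ _ _ _ ⟩
      C zero l * (x * det (minor A l)) + C zero l * (y * det (minor B l))
        ≈⟨ +-cong (*.x∙yz≈y∙xz _ _ _) (*.x∙yz≈y∙xz _ _ _) ⟩
      x * (C zero l * det (minor A l)) + y * (C zero l * det (minor B l))
        ≈⟨ +-cong (*-congˡ (*-congʳ (proj₁ (off zero l l≢j)))) (*-congˡ (*-congʳ (proj₂ (off zero l l≢j)))) ⟩
      x * (A zero l * det (minor A l)) + y * (B zero l * det (minor B l)) ∎))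
      (signed-linear (toℕ l) x y _ _)
      where
      back : punchIn l (punchOut l≢j) ≡ j
      back = Fin.punchIn-punchOut l≢j

  sum-0 : ∀ {n} {t : Fin n → Carrier} → (∀ i → t i ≈ 0#) → sum t ≈ 0#
  sum-0 {n} t≈0 = ≈-trans (sum-cong-≋ t≈0) (sum-replicate-zero n)

  sum-adjacent : ∀ {n} (t : Fin (suc n) → Carrier) (i : Fin n) →
    t (inject₁ i) + t (suc i) ≈ 0# →
    (∀ l → l ≢ inject₁ i → l ≢ suc i → t l ≈ 0#) → sum t ≈ 0#
  sum-adjacent {suc n} t zero    cancel rest = begin
    t zero + (t (suc zero) + sum (λ i → t (suc (suc i))))  ≈⟨ +-assoc _ _ _ ⟨
    t zero + t (suc zero) + sum (λ i → t (suc (suc i)))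
      ≈⟨ +-cong cancel (sum-0 λ i → rest (suc (suc i)) (λ ()) λ ()) ⟩
    0# + 0#                                                ≈⟨ +-identityˡ 0# ⟩
    0#                                                     ∎
  sum-adjacent {suc n} t (suc i) cancel rest = ≈-trans
    (+-cong (rest zero (λ ()) λ ())
            (sum-adjacent (t ∘ suc) i cancel λ l l≢ l≢′ →
              rest (suc l) (l≢ ∘ Fin.suc-injective) (l≢′ ∘ Fin.suc-injective)))
    (+-identityˡ 0#)

  -- Deleting either of two equal neighbouring columns leaves the same minor.
  punchIn-adjacent : ∀ {n} (a : Fin (suc n) → Carrier) (i : Fin n) → a (inject₁ i) ≈ a (suc i) →
    ∀ c → a (punchIn (inject₁ i) c) ≈ a (punchIn (suc i) c)
  punchIn-adjacent a zero    eq zero    = ≈-sym eq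
  punchIn-adjacent a zero    eq (suc c) = ≈-refl
  punchIn-adjacent a (suc i) eq zero    = ≈-refl
  punchIn-adjacent a (suc i) eq (suc c) = punchIn-adjacent (a ∘ suc) i eq c

  -- Two neighbouring columns stay neighbours in a minor that deletes a third one, so induction
  -- applies to that minor.
  adjacent-preimage : ∀ {n} (l : Fin (suc (suc n))) (i : Fin (suc n)) → l ≢ inject₁ i → l ≢ suc i →
    ∃ λ i′ → punchIn l (inject₁ i′) ≡ inject₁ i × punchIn l (suc i′) ≡ suc i
  adjacent-preimage zero          zero    l≢ l≢′ = contradiction refl l≢
  adjacent-preimage zero          (suc i) l≢ l≢′ = i , refl , refl
  adjacent-preimage (suc zero)    zero    l≢ l≢′ = contradiction refl l≢′
  adjacent-preimage {suc n} (suc (suc l)) zero l≢ l≢′ = zero , refl , refl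
  adjacent-preimage {suc n} (suc l) (suc i) l≢ l≢′
    with i′ , eq , eq′ ← adjacent-preimage l i (l≢ ∘ cong suc) (l≢′ ∘ cong suc) =
    suc i′ , cong suc eq , cong suc eq′

  -- The terms at the two equal columns have equal minors and opposite signs; all other minors
  -- vanish by induction.
  det-adjacent : ∀ {n} (A : Matrix (suc n)) (i : Fin n) →
    (∀ r → A r (inject₁ i) ≈ A r (suc i)) → det A ≈ 0#
  det-adjacent {suc n} A i eq = sum-adjacent (λ l → signed (toℕ l) (A zero l * det (minor A l))) i
    (begin
      signed (toℕ (inject₁ i)) (A zero (inject₁ i) * det (minor A (inject₁ i)))
        + - signed (toℕ i) (A zero (suc i) * det (minor A (suc i)))
          ≡⟨ cong (λ k → signed k (A zero (inject₁ i) * det (minor A (inject₁ i)))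
               + - signed (toℕ i) (A zero (suc i) * det (minor A (suc i)))) (Fin.toℕ-inject₁ i) ⟩
      signed (toℕ i) (A zero (inject₁ i) * det (minor A (inject₁ i)))
        + - signed (toℕ i) (A zero (suc i) * det (minor A (suc i)))
          ≈⟨ +-congʳ (signed-cong (toℕ i) (*-cong (eq zero)
               (det-cong λ r → punchIn-adjacent (A (suc r)) i (eq (suc r))))) ⟩
      signed (toℕ i) (A zero (suc i) * det (minor A (suc i)))
        + - signed (toℕ i) (A zero (suc i) * det (minor A (suc i)))
          ≈⟨ -‿inverseʳ _ ⟩
      0# ∎)
    (λ l l≢ l≢′ → let i′ , at , at′ = adjacent-preimage l i l≢ l≢′ in
      signed-0 (toℕ l) (≈-trans (*-congˡ (det-adjacent (minor A l) i′ λ r →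
        subst₂ (λ c c′ → A (suc r) c ≈ A (suc r) c′) (sym at) (sym at′) (eq (suc r))))
        (zeroʳ (A zero l))))

  column : ∀ {n} → Matrix n → Fin n → Fin n → Carrier
  column A j r = A r j

  replace : ∀ {n} → Matrix n → Fin n → (Fin n → Carrier) → Matrix n
  replace A j u r c = if does (c Fin.≟ j) then u r else A r c

  replace-at : ∀ {n} (A : Matrix n) j u r → replace A j u r j ≡ u r
  replace-at A j u r rewrite dec-true (j Fin.≟ j) refl = refl

  replace-off : ∀ {n} (A : Matrix n) j u r {c} → c ≢ j → replace A j u r c ≡ A r c
  replace-off A j u r {c} c≢j rewrite dec-false (c Fin.≟ j) c≢j = refl

  replace-self : ∀ {n} (A : Matrix n) j {u} → (∀ r → u r ≈ A r j) → ∀ r c → replace A j u r c ≈ A r c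
  replace-self A j u≈ r c with c Fin.≟ j
  ... | yes refl = u≈ r
  ... | no  c≢j    = ≈-refl

  det-replace-linear : ∀ {n} (A : Matrix n) j x y {u v w : Fin n → Carrier} →
    (∀ r → w r ≈ x * u r + y * v r) →
    det (replace A j w) ≈ x * det (replace A j u) + y * det (replace A j v)
  det-replace-linear A j x y {u} {v} {w} w≈ = det-linear j x y
    (λ r c c≢j →
      reflexive (trans (replace-off A j w r c≢j) (sym (replace-off A j u r c≢j))) ,
      reflexive (trans (replace-off A j w r c≢j) (sym (replace-off A j v r c≢j))))
    (λ r → begin
      replace A j w r j                              ≡⟨ replace-at A j w r ⟩
      w r                                            ≈⟨ w≈ r ⟩
      x * u r + y * v r
        ≡⟨ cong₂ (λ a b → x * a + y * b) (replace-at A j u r) (replace-at A j v r) ⟨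
      x * replace A j u r j + y * replace A j v r j  ∎)

  -- Polarisation: with u + v in both columns the determinant vanishes, and its bilinear expansion
  -- leaves only the two mixed terms.
  det-swap : ∀ {n} (A : Matrix (suc n)) (i : Fin n) (u v : Fin (suc n) → Carrier) →
    det (replace (replace A (inject₁ i) u) (suc i) v) + det (replace (replace A (inject₁ i) v) (suc i) u) ≈ 0#
  det-swap {n} A i u v = begin
    D u v + D v u                        ≈⟨ +-cong (+-identityˡ _) (+-identityʳ _) ⟨
    (0# + D u v) + (D v u + 0#)          ≈⟨ +-cong (+-congʳ (D-alt u)) (+-congˡ (D-alt v)) ⟨
    (D u u + D u v) + (D v u + D v v)    ≈⟨ +-cong (D-addʳ u) (D-addʳ v) ⟨
    -- Linearity is available for the outermost replacement only, so `flip` exchanges the two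
    -- replacements before the left column is treated.
    D u u+v + D v u+v                    ≈⟨ +-cong (flip u u+v) (flip v u+v) ⟩
    D′ u+v u + D′ u+v v                  ≈⟨ add (replace A (suc i) u+v) (inject₁ i) ⟨
    D′ u+v u+v                           ≈⟨ flip u+v u+v ⟨
    D u+v u+v                            ≈⟨ D-alt u+v ⟩
    0#                                   ∎
    where
    D D′ : (u v : Fin (suc n) → Carrier) → Carrier
    D u v = det (replace (replace A (inject₁ i) u) (suc i) v)
    D′ v u = det (replace (replace A (suc i) v) (inject₁ i) u)

    u+v : Fin (suc n) → Carrier
    u+v r = u r + v r

    i≢ : inject₁ i ≢ suc i
    i≢ eq = ℕ.1+n≢n (trans (sym (cong toℕ eq)) (Fin.toℕ-inject₁ i))

    flip : ∀ u v → D u v ≈ D′ v u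
    flip u v = det-cong entry
      where
      entry : ∀ r c → replace (replace A (inject₁ i) u) (suc i) v r c ≈ replace (replace A (suc i) v) (inject₁ i) u r c
      entry r c with c Fin.≟ suc i | c Fin.≟ inject₁ i
      ... | yes refl | yes eq = contradiction (sym eq) i≢
      ... | yes _      | no _   = ≈-refl
      ... | no _       | yes _  = ≈-refl
      ... | no _       | no _   = ≈-refl

    D-alt : ∀ w → D w w ≈ 0#
    D-alt w = det-adjacent (replace (replace A (inject₁ i) w) (suc i) w) i λ r → reflexive (trans
      (trans (replace-off (replace A (inject₁ i) w) (suc i) w r i≢) (replace-at A (inject₁ i) w r))
      (sym (replace-at (replace A (inject₁ i) w) (suc i) w r)))

    add : ∀ B j → det (replace B j u+v) ≈ det (replace B j u) + det (replace B j v)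
    add B j = ≈-trans (det-replace-linear B j 1# 1# {u} {v} {u+v} λ r → ≈-sym (+-cong (*-identityˡ _) (*-identityˡ _)))
      (+-cong (*-identityˡ _) (*-identityˡ _))

    D-addʳ : ∀ w → D w u+v ≈ D w u + D w v
    D-addʳ w = add (replace A (inject₁ i) w) (suc i)

  -- Swaps of neighbours move the right column leftwards until it stands next to column `j`; each
  -- swap changes only the sign. The bound `d` carries the recursion, since `inject₁ k` is not a
  -- structural part of `suc k`.
  det-equal-columns-< : ∀ {n} d (A : Matrix n) j k → toℕ k ℕ.≤ d → j Fin.< k →
    (∀ r → A r j ≈ A r k) → det A ≈ 0#
  det-equal-columns-< {suc n} (suc d) A j (suc k) (s≤s k≤d) j<k eq with j Fin.≟ inject₁ k
  ... | yes refl = det-adjacent A k eq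
  ... | no  j≢k    = begin
    det A
      ≈⟨ det-cong (λ r c → ≈-trans
           (replace-self (replace A (inject₁ k) (column A (inject₁ k))) (suc k) (λ r → ≈-sym
             (reflexive (replace-off A (inject₁ k) (column A (inject₁ k)) r (k≢ ∘ sym)))) r c)
           (replace-self A (inject₁ k) (λ _ → ≈-refl) r c)) ⟨
    det (replace (replace A (inject₁ k) (column A (inject₁ k))) (suc k) (column A (suc k)))
      ≈⟨ +-identityʳ _ ⟨
    det (replace (replace A (inject₁ k) (column A (inject₁ k))) (suc k) (column A (suc k))) + 0#
      ≈⟨ +-congˡ (det-equal-columns-< d swapped j (inject₁ k)
           (subst (ℕ._≤ d) (sym (Fin.toℕ-inject₁ k)) k≤d)
           (ℕ.≤∧≢⇒< (subst (toℕ j ℕ.≤_) (sym (Fin.toℕ-inject₁ k)) (s≤s⁻¹ j<k)) (j≢k ∘ Fin.toℕ-injective))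
           swapped-eq) ⟨
    det (replace (replace A (inject₁ k) (column A (inject₁ k))) (suc k) (column A (suc k))) + det swapped
      ≈⟨ det-swap A k (column A (inject₁ k)) (column A (suc k)) ⟩
    0# ∎
    where
    swapped : Matrix (suc n)
    swapped = replace (replace A (inject₁ k) (column A (suc k))) (suc k) (column A (inject₁ k))

    k≢ : inject₁ k ≢ suc k
    k≢ eq = ℕ.1+n≢n (trans (sym (cong toℕ eq)) (Fin.toℕ-inject₁ k))

    swapped-eq : ∀ r → swapped r j ≈ swapped r (inject₁ k)
    swapped-eq r = begin
      swapped r j             ≡⟨ replace-off (replace A (inject₁ k) (column A (suc k))) (suc k) (column A (inject₁ k)) r (Fin.<⇒≢ j<k) ⟩
      replace A (inject₁ k) (column A (suc k)) r j ≡⟨ replace-off A (inject₁ k) (column A (suc k)) r j≢k ⟩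
      A r j                   ≈⟨ eq r ⟩
      A r (suc k)             ≡⟨ replace-at A (inject₁ k) (column A (suc k)) r ⟨
      replace A (inject₁ k) (column A (suc k)) r (inject₁ k)
        ≡⟨ replace-off (replace A (inject₁ k) (column A (suc k))) (suc k) (column A (inject₁ k)) r k≢ ⟨
      swapped r (inject₁ k)   ∎

  det-equal-columns : ∀ {n} (A : Matrix n) j k → j ≢ k → (∀ r → A r j ≈ A r k) → det A ≈ 0#
  det-equal-columns A j k j≢k eq with Fin.<-cmp j k
  ... | tri< j<k _ _ = det-equal-columns-< (toℕ k) A j k ℕ.≤-refl j<k eq
  ... | tri≈ _ j≡k _ = contradiction j≡k j≢k
  ... | tri> _ _ k<j = det-equal-columns-< (toℕ j) A k j ℕ.≤-refl k<j (≈-sym ∘ eq)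

  δ : ∀ {n} → Fin n → Fin n → Carrier
  δ i j = if does (i Fin.≟ j) then 1# else 0#

  sum-δ : ∀ {n} (f : Fin n → Carrier) j → sum (λ i → f i * δ i j) ≈ f j
  sum-δ {suc n} f zero    = ≈-trans (+-cong (*-identityʳ _) (sum-0 λ i → zeroʳ (f (suc i)))) (+-identityʳ _)
  sum-δ {suc n} f (suc j) = ≈-trans (+-cong (zeroʳ _) (sum-δ (f ∘ suc) j)) (+-identityˡ _)

  det-replace-sum : ∀ {m n} (A : Matrix n) j (x : Fin m → Carrier) (u : Fin m → Fin n → Carrier) →
    det (replace A j (λ r → sum λ i → x i * u i r)) ≈ sum λ i → x i * det (replace A j (u i))
  -- The empty combination is a zero column, written as `0#` times one column plus `0#` times
  -- another, so linearity makes the determinant zero.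
  det-replace-sum {zero}  A j x u = ≈-trans
    (det-replace-linear A j 0# 0# {λ _ → 0#} {λ _ → 0#} {λ _ → 0#} (λ r → ≈-sym 0≈))
    0≈
    where
    0≈ : ∀ {a b} → 0# * a + 0# * b ≈ 0#
    0≈ = ≈-trans (+-cong (zeroˡ _) (zeroˡ _)) (+-identityˡ _)
  det-replace-sum {suc m} A j x u = ≈-trans
    (det-replace-linear A j (x zero) 1#
      {u zero} {λ r → sum λ i → x (suc i) * u (suc i) r} (λ r → +-congˡ (≈-sym (*-identityˡ _))))
    (+-congˡ (≈-trans (*-identityˡ _) (det-replace-sum A j (x ∘ suc) (u ∘ suc))))

  -- The cofactor, expressed as a determinant with a unit vector in column `j`; signs and deleted
  -- rows are thereby hidden in `det`.
  adjugate : ∀ {n} → Matrix n → Matrix n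
  adjugate A j i = det (replace A j (λ r → δ i r))

  -- Cramer's rule: by linearity the sum is the determinant of `A` with column `j` replaced by
  -- column `k`. For `j ≢ k` that matrix has two equal columns.
  adjugate-inverseˡ : ∀ {n} (A : Matrix n) j k → sum (λ i → adjugate A j i * A i k) ≈ det A * δ j k
  adjugate-inverseˡ A j k = begin
    sum (λ i → adjugate A j i * A i k)           ≈⟨ sum-cong-≋ (λ i → *-comm (adjugate A j i) (A i k)) ⟩
    sum (λ i → A i k * adjugate A j i)           ≈⟨ det-replace-sum A j (λ i → A i k) δ ⟨
    det (replace A j (λ r → sum λ i → A i k * δ i r)) ≈⟨ det-cong replace-sum ⟩
    det (replace A j (column A k))              ≈⟨ cofactor ⟩
    det A * δ j k                                ∎
    where
    replace-sum : ∀ r c → replace A j (λ r → sum λ i → A i k * δ i r) r c ≈ replace A j (column A k) r c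
    replace-sum r c with does (c Fin.≟ j)
    ... | true  = sum-δ (λ i → A i k) r
    ... | false = ≈-refl

    cofactor : det (replace A j (column A k)) ≈ det A * δ j k
    cofactor with j Fin.≟ k
    ... | yes refl = ≈-trans (det-cong (replace-self A j λ _ → ≈-refl)) (≈-sym (*-identityʳ _))
    ... | no  j≢k    = ≈-trans
      (det-equal-columns (replace A j (column A k)) j k j≢k λ r → reflexive (trans (replace-at A j (column A k) r)
        (sym (replace-off A j (column A k) r (j≢k ∘ sym)))))
      (≈-sym (zeroʳ _))

-- Polynomials

module Polynomials {q : ℕ} (F : FiniteField q) where
  open FiniteField F
  open FF F

  fieldRing : CommutativeRing 0ℓ 0ℓ
  fieldRing = record { isCommutativeRing = isCommutativeRing }

  open IsCommutativeRing isCommutativeRing using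
    ( +-assoc; +-comm; +-identityˡ; +-identityʳ; -‿inverseˡ; -‿inverseʳ
    ; *-assoc; *-comm; *-identityˡ; *-identityʳ; distribˡ; distribʳ; zeroˡ; zeroʳ) public
  open import Algebra.Properties.Ring (CommutativeRing.ring fieldRing) public
    using (-0#≈0#; -‿involutive)

  *-nonzero : ∀ {x y} → x ≢ 0# → y ≢ 0# → x * y ≢ 0#
  *-nonzero {x} {y} x≢0 y≢0 xy≡0 = y≢0 (begin
    y                 ≡⟨ *-identityˡ y ⟨
    1# * y            ≡⟨ cong (_* y) (trans (sym xx⁻¹≡1) (*-comm x x⁻¹)) ⟩
    x⁻¹ * x * y       ≡⟨ *-assoc x⁻¹ x y ⟩
    x⁻¹ * (x * y)     ≡⟨ cong (x⁻¹ *_) xy≡0 ⟩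
    x⁻¹ * 0#          ≡⟨ zeroʳ x⁻¹ ⟩
    0#                ∎)
    where
    open ≡-Reasoning
    x⁻¹ = proj₁ (inverse x x≢0)
    xx⁻¹≡1 = proj₂ (inverse x x≢0)

  coeff : Poly → ℕ → Carrier
  coeff []      i       = 0#
  coeff (a ∷ f) zero    = a
  coeff (a ∷ f) (suc i) = coeff f i

  infix 4 _≐_
  -- Equivalent to `_≈P_` but independent of `normalize`, hence compatible with the arithmetic at
  -- once. A record rather than a function type, so that unification can recover `f` and `g`.
  record _≐_ (f g : Poly) : Set where
    constructor coeffwise
    field coeff-≡ : ∀ i → coeff f i ≡ coeff g i
  open _≐_ public

  ≐-refl : ∀ {f} → f ≐ f
  ≐-refl = coeffwise λ _ → refl

  ≐-sym : ∀ {f g} → f ≐ g → g ≐ f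
  ≐-sym (coeffwise p) = coeffwise (sym ∘ p)

  ≐-trans : ∀ {f g h} → f ≐ g → g ≐ h → f ≐ h
  ≐-trans (coeffwise p) (coeffwise p′) = coeffwise λ i → trans (p i) (p′ i)

  ∷-cong : ∀ {a b f g} → a ≡ b → f ≐ g → a ∷ f ≐ b ∷ g
  ∷-cong a≡b (coeffwise p) = coeffwise λ { zero → a≡b ; (suc i) → p i }

  tail-≐ : ∀ {a b f g} → a ∷ f ≐ b ∷ g → f ≐ g
  tail-≐ (coeffwise p) = coeffwise (p ∘ suc)

  tail-≐[] : ∀ {a f} → a ∷ f ≐ [] → f ≐ []
  tail-≐[] (coeffwise p) = coeffwise (p ∘ suc)

  normalize-≐ : ∀ f → normalize f ≐ f
  normalize-≐ [] = ≐-refl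
  normalize-≐ (a ∷ f) with normalize f | normalize-≐ f
  ... | b ∷ g | nf = ∷-cong refl nf
  ... | []    | nf with a ≟ 0#
  ...   | yes a≡0 = coeffwise λ { zero → sym a≡0 ; (suc i) → coeff-≡ nf i }
  ...   | no  a≢0 = ∷-cong refl nf

  ≐[]⇒normalize : ∀ {f} → f ≐ [] → normalize f ≡ []
  ≐[]⇒normalize {[]}    _  = refl
  ≐[]⇒normalize {a ∷ f} f≐ rewrite ≐[]⇒normalize (tail-≐[] f≐) with a ≟ 0#
  ... | yes _   = refl
  ... | no  a≢0 = contradiction (coeff-≡ f≐ 0) a≢0

  ≐⇒≈P : ∀ {f g} → f ≐ g → f ≈P g
  ≐⇒≈P {f}     {[]}    f≐g = ≐[]⇒normalize f≐g
  ≐⇒≈P {[]}    {b ∷ g} f≐g = sym (≐[]⇒normalize (≐-sym f≐g))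
  ≐⇒≈P {a ∷ f} {b ∷ g} f≐g rewrite coeff-≡ f≐g 0 | ≐⇒≈P {f} {g} (tail-≐ f≐g) = refl

  ≈P⇒≐ : ∀ {f g} → f ≈P g → f ≐ g
  ≈P⇒≐ {f} {g} f≈g = ≐-trans (≐-sym (normalize-≐ f)) (subst (_≐ g) (sym f≈g) (normalize-≐ g))

  coeff-+ : ∀ f g i → coeff (f +P g) i ≡ coeff f i + coeff g i
  coeff-+ []      g       i       = sym (+-identityˡ _)
  coeff-+ (a ∷ f) []      i       = sym (+-identityʳ _)
  coeff-+ (a ∷ f) (b ∷ g) zero    = refl
  coeff-+ (a ∷ f) (b ∷ g) (suc i) = coeff-+ f g i

  coeff-neg : ∀ f i → coeff (negP f) i ≡ - coeff f i
  coeff-neg []      i       = sym -0#≈0#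
  coeff-neg (a ∷ f) zero    = refl
  coeff-neg (a ∷ f) (suc i) = coeff-neg f i

  coeff-scale : ∀ a f i → coeff (scaleP a f) i ≡ a * coeff f i
  coeff-scale a []      i       = sym (zeroʳ a)
  coeff-scale a (b ∷ f) zero    = refl
  coeff-scale a (b ∷ f) (suc i) = coeff-scale a f i

  +P-cong : ∀ {f f′ g g′} → f ≐ f′ → g ≐ g′ → f +P g ≐ f′ +P g′
  +P-cong {f} {f′} {g} {g′} p p′ = coeffwise λ i → trans (coeff-+ f g i)
    (trans (cong₂ _+_ (coeff-≡ p i) (coeff-≡ p′ i)) (sym (coeff-+ f′ g′ i)))

  +P-abelianGroup : AbelianGroup 0ℓ 0ℓ
  +P-abelianGroup = record
    { Carrier = Poly ; _≈_ = _≐_ ; _∙_ = _+P_ ; ε = [] ; _⁻¹ = negP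
    ; isAbelianGroup = record
      { isGroup = record
        { isMonoid = record
          { isSemigroup = record
            { isMagma = record
              { isEquivalence = record { refl = ≐-refl ; sym = ≐-sym ; trans = ≐-trans }
              ; ∙-cong = +P-cong }
            ; assoc = λ f g h → coeffwise λ i → trans (coeff-+ (f +P g) h i)
                (trans (cong (_+ coeff h i) (coeff-+ f g i)) (trans (+-assoc _ _ _)
                (sym (trans (coeff-+ f (g +P h) i) (cong (coeff f i +_) (coeff-+ g h i)))))) }
          ; identity = (λ f → ≐-refl) , λ f → coeffwise λ i → trans (coeff-+ f [] i) (+-identityʳ _) }
        ; inverse =
            (λ f → coeffwise λ i → trans (coeff-+ (negP f) f i)
              (trans (cong (_+ coeff f i) (coeff-neg f i)) (-‿inverseˡ _))) ,
            (λ f → coeffwise λ i → trans (coeff-+ f (negP f) i)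
              (trans (cong (coeff f i +_) (coeff-neg f i)) (-‿inverseʳ _)))
        ; ⁻¹-cong = λ {f} {g} p → coeffwise λ i → trans (coeff-neg f i)
            (trans (cong -_ (coeff-≡ p i)) (sym (coeff-neg g i))) }
      ; comm = λ f g → coeffwise λ i → trans (coeff-+ f g i)
          (trans (+-comm _ _) (sym (coeff-+ g f i))) } }

  private
    module +P = AbelianGroup +P-abelianGroup
    open import Algebra.Properties.CommutativeSemigroup +P.commutativeSemigroup
      using (interchange; x∙yz≈y∙xz)
    open import Relation.Binary.Reasoning.Setoid +P.setoid

  scale-cong : ∀ {a b f g} → a ≡ b → f ≐ g → scaleP a f ≐ scaleP b g
  scale-cong {a} {b} {f} {g} p p′ = coeffwise λ i → trans (coeff-scale a f i)
    (trans (cong₂ _*_ p (coeff-≡ p′ i)) (sym (coeff-scale b g i)))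

  scale-distribˡ : ∀ a f g → scaleP a (f +P g) ≐ scaleP a f +P scaleP a g
  scale-distribˡ a f g = coeffwise λ i → trans (coeff-scale a (f +P g) i)
    (trans (cong (a *_) (coeff-+ f g i)) (trans (distribˡ a _ _)
    (sym (trans (coeff-+ (scaleP a f) _ i) (cong₂ _+_ (coeff-scale a f i) (coeff-scale a g i))))))

  scale-distribʳ : ∀ a b f → scaleP (a + b) f ≐ scaleP a f +P scaleP b f
  scale-distribʳ a b f = coeffwise λ i → trans (coeff-scale (a + b) f i)
    (trans (distribʳ _ a b)
    (sym (trans (coeff-+ (scaleP a f) _ i) (cong₂ _+_ (coeff-scale a f i) (coeff-scale b f i)))))

  scale-assoc : ∀ a b f → scaleP a (scaleP b f) ≐ scaleP (a * b) f
  scale-assoc a b f = coeffwise λ i → trans (coeff-scale a (scaleP b f) i)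
    (trans (cong (a *_) (coeff-scale b f i)) (trans (sym (*-assoc a b _)) (sym (coeff-scale (a * b) f i))))

  scale-0 : ∀ f → scaleP 0# f ≐ []
  scale-0 f = coeffwise λ i → trans (coeff-scale 0# f i) (zeroˡ _)

  scale-1 : ∀ f → scaleP 1# f ≐ f
  scale-1 f = coeffwise λ i → trans (coeff-scale 1# f i) (*-identityˡ _)

  shift-[] : 0# ∷ [] ≐ []
  shift-[] = coeffwise λ { zero → refl ; (suc i) → refl }

  shift-+ : ∀ f g → 0# ∷ (f +P g) ≐ (0# ∷ f) +P (0# ∷ g)
  shift-+ f g = ∷-cong (sym (+-identityˡ 0#)) ≐-refl

  scale-shift : ∀ a f → scaleP a (0# ∷ f) ≐ 0# ∷ scaleP a f
  scale-shift a f = ∷-cong (zeroʳ a) ≐-refl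

  *P-zeroʳ : ∀ f → f *P [] ≐ []
  *P-zeroʳ []      = ≐-refl
  *P-zeroʳ (a ∷ f) = ≐-trans (∷-cong refl (*P-zeroʳ f)) shift-[]

  *P-zeroˡ : ∀ {f} → f ≐ [] → ∀ g → f *P g ≐ []
  *P-zeroˡ {[]}    _  g = ≐-refl
  *P-zeroˡ {a ∷ f} f≐ g = begin
    scaleP a g +P (0# ∷ (f *P g))
      ≈⟨ +P-cong (≐-trans (scale-cong (coeff-≡ f≐ 0) ≐-refl) (scale-0 g))
                 (≐-trans (∷-cong refl (*P-zeroˡ (tail-≐[] f≐) g)) shift-[]) ⟩
    [] ∎

  *P-congˡ : ∀ f {g g′} → g ≐ g′ → f *P g ≐ f *P g′
  *P-congˡ []      g≐ = ≐-refl
  *P-congˡ (a ∷ f) g≐ = +P-cong (scale-cong refl g≐) (∷-cong refl (*P-congˡ f g≐))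

  *P-congʳ : ∀ {f f′} g → f ≐ f′ → f *P g ≐ f′ *P g
  *P-congʳ {[]}    {f′}     g f≐ = ≐-sym (*P-zeroˡ (≐-sym f≐) g)
  *P-congʳ {a ∷ f} {[]}     g f≐ = *P-zeroˡ f≐ g
  *P-congʳ {a ∷ f} {b ∷ f′} g f≐ =
    +P-cong (scale-cong (coeff-≡ f≐ 0) ≐-refl) (∷-cong refl (*P-congʳ g (tail-≐ f≐)))

  *P-distribʳ : ∀ h f g → (f +P g) *P h ≐ f *P h +P g *P h
  *P-distribʳ h []      g       = ≐-refl
  *P-distribʳ h (a ∷ f) []      = ≐-sym (+P.identityʳ _)
  *P-distribʳ h (a ∷ f) (b ∷ g) = begin
    scaleP (a + b) h +P (0# ∷ ((f +P g) *P h))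
      ≈⟨ +P-cong (scale-distribʳ a b h)
           (≐-trans (∷-cong refl (*P-distribʳ h f g)) (shift-+ (f *P h) (g *P h))) ⟩
    (scaleP a h +P scaleP b h) +P ((0# ∷ (f *P h)) +P (0# ∷ (g *P h)))
      ≈⟨ interchange (scaleP a h) _ _ _ ⟩
    (scaleP a h +P (0# ∷ (f *P h))) +P (scaleP b h +P (0# ∷ (g *P h))) ∎

  scale-*P : ∀ a f g → scaleP a f *P g ≐ scaleP a (f *P g)
  scale-*P a []      g = ≐-refl
  scale-*P a (b ∷ f) g = begin
    scaleP (a * b) g +P (0# ∷ (scaleP a f *P g))
      ≈⟨ +P-cong (≐-sym (scale-assoc a b g))
           (≐-trans (∷-cong refl (scale-*P a f g)) (≐-sym (scale-shift a (f *P g)))) ⟩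
    scaleP a (scaleP b g) +P scaleP a (0# ∷ (f *P g))  ≈⟨ scale-distribˡ a (scaleP b g) (0# ∷ (f *P g)) ⟨
    scaleP a (scaleP b g +P (0# ∷ (f *P g)))           ∎

  shift-*P : ∀ f g → (0# ∷ f) *P g ≐ 0# ∷ (f *P g)
  shift-*P f g = +P-cong (scale-0 g) ≐-refl

  *P-assoc : ∀ f g h → (f *P g) *P h ≐ f *P (g *P h)
  *P-assoc []      g h = ≐-refl
  *P-assoc (a ∷ f) g h = begin
    (scaleP a g +P (0# ∷ (f *P g))) *P h
      ≈⟨ *P-distribʳ h (scaleP a g) _ ⟩
    scaleP a g *P h +P (0# ∷ (f *P g)) *P h
      ≈⟨ +P-cong (scale-*P a g h) (≐-trans (shift-*P (f *P g) h) (∷-cong refl (*P-assoc f g h))) ⟩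
    scaleP a (g *P h) +P (0# ∷ (f *P (g *P h))) ∎

  -- `_*P_` recurses on its left factor. Unfolding the right factor too yields commutativity, and is
  -- the step of long division.
  *P-∷ : ∀ f b g → f *P (b ∷ g) ≐ scaleP b f +P (0# ∷ (f *P g))
  *P-∷ []      b g = ≐-sym shift-[]
  *P-∷ (a ∷ f) b g = ∷-cong (cong (_+ 0#) (*-comm a b)) (begin
    scaleP a g +P f *P (b ∷ g)                         ≈⟨ +P-cong ≐-refl (*P-∷ f b g) ⟩
    scaleP a g +P (scaleP b f +P (0# ∷ (f *P g)))      ≈⟨ x∙yz≈y∙xz (scaleP a g) (scaleP b f) (0# ∷ (f *P g)) ⟩
    scaleP b f +P (scaleP a g +P (0# ∷ (f *P g)))      ∎)

  *P-comm : ∀ f g → f *P g ≐ g *P f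
  *P-comm f []      = *P-zeroʳ f
  *P-comm f (b ∷ g) = ≐-trans (*P-∷ f b g) (+P-cong ≐-refl (∷-cong refl (*P-comm f g)))

  *P-cong : ∀ {f f′ g g′} → f ≐ f′ → g ≐ g′ → f *P g ≐ f′ *P g′
  *P-cong {f} {f′} {g} {g′} p p′ = ≐-trans (*P-congʳ g p) (*P-congˡ f′ p′)

  *P-identityˡ : ∀ f → oneP *P f ≐ f
  *P-identityˡ f = ≐-trans (+P-cong (scale-1 f) shift-[]) (+P.identityʳ f)

  +P-identityʳ : ∀ f → f +P [] ≐ f
  +P-identityʳ = +P.identityʳ

  polyRing : CommutativeRing 0ℓ 0ℓ
  polyRing = record
    { Carrier = Poly ; _≈_ = _≐_ ; _+_ = _+P_ ; _*_ = _*P_ ; -_ = negP ; 0# = [] ; 1# = oneP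
    ; isCommutativeRing = record
      { isRing = record
        { +-isAbelianGroup = AbelianGroup.isAbelianGroup +P-abelianGroup
        ; *-cong = *P-cong
        ; *-assoc = *P-assoc
        ; *-identity = *P-identityˡ , λ f → ≐-trans (*P-comm f oneP) (*P-identityˡ f)
        ; distrib =
            (λ f g h → ≐-trans (*P-comm f (g +P h)) (≐-trans (*P-distribʳ f g h)
              (+P-cong (*P-comm g f) (*P-comm h f)))) ,
            *P-distribʳ
        }
      ; *-comm = *P-comm } }

  -- deg f < n, with deg 0 = -∞.
  DegreeBelow : ℕ → Poly → Set
  DegreeBelow n f = ∀ i → n ℕ.≤ i → coeff f i ≡ 0#

  degreeBelow-cong : ∀ {n f g} → f ≐ g → DegreeBelow n f → DegreeBelow n g
  degreeBelow-cong f≐g below i n≤i = trans (sym (coeff-≡ f≐g i)) (below i n≤i)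

  degreeBelow-mono : ∀ {m n} f → m ℕ.≤ n → DegreeBelow m f → DegreeBelow n f
  degreeBelow-mono f m≤n below i n≤i = below i (ℕ.≤-trans m≤n n≤i)

  degreeBelow-+ : ∀ {n} f g → DegreeBelow n f → DegreeBelow n g → DegreeBelow n (f +P g)
  degreeBelow-+ f g bf bg i n≤i = trans (coeff-+ f g i)
    (trans (cong₂ _+_ (bf i n≤i) (bg i n≤i)) (+-identityˡ 0#))

  degreeBelow-neg : ∀ {n} f → DegreeBelow n f → DegreeBelow n (negP f)
  degreeBelow-neg f bf i n≤i = trans (coeff-neg f i) (trans (cong -_ (bf i n≤i)) -0#≈0#)

  degreeBelow-0 : ∀ {f} → DegreeBelow 0 f → f ≐ []
  degreeBelow-0 below = coeffwise λ i → below i z≤n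

  -- The bounds are asymmetric in order to be sharp: deg f ≤ m and deg g < n, where `n = 0` covers g
  -- = 0.
  degreeBelow-* : ∀ {m n} f g → DegreeBelow (suc m) f → DegreeBelow n g → DegreeBelow (m ℕ.+ n) (f *P g)
  degreeBelow-* []      g bf bg i _ = refl
  degreeBelow-* {m} {n} (a ∷ f) g bf bg i m+n≤i = trans (coeff-+ (scaleP a g) _ i)
    (trans (cong₂ _+_
      (trans (coeff-scale a g i) (trans (cong (a *_) (bg i (ℕ.≤-trans (ℕ.m≤n+m n m) m+n≤i))) (zeroʳ a)))
      (shifted m i bf m+n≤i))
    (+-identityˡ 0#))
    where
    shifted : ∀ m i → DegreeBelow (suc m) (a ∷ f) → m ℕ.+ n ℕ.≤ i → coeff (0# ∷ (f *P g)) i ≡ 0#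
    shifted m       zero    bf _    = refl
    shifted zero    (suc i) bf _    = coeff-≡ (*P-zeroˡ {f} (coeffwise λ j → bf (suc j) (s≤s z≤n)) g) i
    shifted (suc m) (suc i) bf le   = degreeBelow-* f g (λ j le → bf (suc j) (s≤s le)) bg i (s≤s⁻¹ le)

  coeff-*-top : ∀ m n f g → DegreeBelow (suc m) f → DegreeBelow (suc n) g →
    coeff (f *P g) (m ℕ.+ n) ≡ coeff f m * coeff g n
  coeff-*-top m       n []      g bf bg = sym (zeroˡ _)
  coeff-*-top zero    n (a ∷ f) g bf bg = trans (coeff-+ (scaleP a g) _ n)
    (trans (cong₂ _+_ (coeff-scale a g n)
      (coeff-≡ (≐-trans (∷-cong refl (*P-zeroˡ {f} (coeffwise λ j → bf (suc j) (s≤s z≤n)) g)) shift-[]) n))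
    (+-identityʳ _))
  coeff-*-top (suc m) n (a ∷ f) g bf bg = trans (coeff-+ (scaleP a g) _ (suc m ℕ.+ n))
    (trans (cong₂ _+_
      (trans (coeff-scale a g _) (trans (cong (a *_) (bg _ (s≤s (ℕ.m≤n+m n m)))) (zeroʳ a)))
      (coeff-*-top m n f g (λ j le → bf (suc j) (s≤s le)) bg))
    (+-identityˡ _))

  leading : ∀ f → f ≐ [] ⊎ ∃ λ k →
    length (normalize f) ≡ suc k × coeff f k ≢ 0# × DegreeBelow (suc k) f
  leading []      = inj₁ ≐-refl
  leading (a ∷ f) with leading f
  ... | inj₁ f≐[] rewrite ≐[]⇒normalize f≐[] with a ≟ 0#
  ...   | yes a≡0 = inj₁ (coeffwise λ { zero → a≡0 ; (suc i) → coeff-≡ f≐[] i })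
  ...   | no  a≢0 = inj₂ (0 , refl , a≢0 , λ { (suc i) _ → coeff-≡ f≐[] i })
  leading (a ∷ f) | inj₂ (k , len , top , below) with normalize f | len
  ... | b ∷ g | len = inj₂ (suc k , cong suc len , top , λ { (suc i) (s≤s le) → below i le })

  deg-unique : ∀ f k → coeff f k ≢ 0# → DegreeBelow (suc k) f → deg f ≡ k
  deg-unique f k top below with leading f
  ... | inj₁ f≐[] = contradiction (coeff-≡ f≐[] k) top
  ... | inj₂ (k′ , len , top′ , below′) rewrite len with ℕ.<-cmp k′ k
  ...   | tri< k′<k _ _ = contradiction (below′ k k′<k) top
  ...   | tri≈ _ k′≡k _ = k′≡k
  ...   | tri> _ _ k<k′ = contradiction (below k′ k<k′) top′

  deg≡0⇒degreeBelow : ∀ f → deg f ≡ 0 → DegreeBelow 1 f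
  deg≡0⇒degreeBelow f deg≡0 with leading f
  ... | inj₁ f≐[] = λ i _ → coeff-≡ f≐[] i
  ... | inj₂ (k , len , _ , below) =
    subst (λ n → DegreeBelow (suc n) f) (trans (cong (ℕ._∸ 1) (sym len)) deg≡0) below

  Monic : ℕ → Poly → Set
  Monic d f = coeff f d ≡ 1# × DegreeBelow (suc d) f

  monic-nonzero : ∀ {d f} → Monic d f → coeff f d ≢ 0#
  monic-nonzero (top , _) ≡0 = 0≢1 (trans (sym ≡0) top)

  deg-monic : ∀ {d f} → Monic d f → deg f ≡ d
  deg-monic {d} {f} monic = deg-unique f d (monic-nonzero {f = f} monic) (proj₂ monic)

  -- The leading coefficients of `f` and `h` multiply to a nonzero coefficient of `g`, so `h` cannot
  -- outgrow `g`. This bounds the searches for factors and quotients.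
  factor-degreeBelow : ∀ {a n} f g h → coeff f a ≢ 0# → DegreeBelow (suc a) f →
    f *P h ≐ g → DegreeBelow n g → DegreeBelow n h
  factor-degreeBelow {a} {n} f g h top bf fh≐g bg with leading h
  ... | inj₁ h≐[] = λ i _ → coeff-≡ h≐[] i
  ... | inj₂ (k , _ , htop , bh) = degreeBelow-mono h (ℕ.≤-trans (s≤s (ℕ.m≤n+m k a)) a+k<n) bh
    where
    a+k<n : a ℕ.+ k ℕ.< n
    a+k<n = ℕ.≰⇒> λ n≤a+k → *-nonzero top htop
      (trans (sym (coeff-*-top a k f h bf bh)) (trans (coeff-≡ fh≐g _) (bg _ n≤a+k)))

  coefficients : ∀ n → Poly → Vec Carrier n
  coefficients n f = tabulate (coeff f ∘ toℕ)

  coeff-toList : ∀ {n} (cs : Vec Carrier n) i → coeff (toList cs) (toℕ i) ≡ lookup cs i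
  coeff-toList (c ∷ cs) zero    = refl
  coeff-toList (c ∷ cs) (suc i) = coeff-toList cs i

  coeff-monicPoly : ∀ {n} (cs : Vec Carrier n) i → coeff (monicPoly cs) (toℕ i) ≡ lookup cs i
  coeff-monicPoly (c ∷ cs) zero    = refl
  coeff-monicPoly (c ∷ cs) (suc i) = coeff-monicPoly cs i

  monicPoly-monic : ∀ {n} (cs : Vec Carrier n) → Monic n (monicPoly cs)
  monicPoly-monic []       = refl , λ { (suc i) _ → refl }
  monicPoly-monic (c ∷ cs) = proj₁ (monicPoly-monic cs) ,
    λ { (suc i) (s≤s le) → proj₂ (monicPoly-monic cs) i le }

  degreeBelow⇒≐ : ∀ n f → DegreeBelow n f → f ≐ toList (coefficients n f)
  degreeBelow⇒≐ n f below = coeffwise (go n f below)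
    where
    go : ∀ n f → DegreeBelow n f → ∀ i → coeff f i ≡ coeff (toList (coefficients n f)) i
    go zero    f       below i       = below i z≤n
    go (suc n) f       below zero    = refl
    go (suc n) []      below (suc i) = go n [] (λ _ _ → refl) i
    go (suc n) (a ∷ f) below (suc i) = go n f (λ j le → below (suc j) (s≤s le)) i

  monic⇒≐ : ∀ n f → Monic n f → f ≐ monicPoly (coefficients n f)
  monic⇒≐ n f (top , below) = coeffwise (go n f top below)
    where
    go : ∀ n f → coeff f n ≡ 1# → DegreeBelow (suc n) f → ∀ i → coeff f i ≡ coeff (monicPoly (coefficients n f)) i
    go zero    f       top below zero    = top
    go zero    f       top below (suc i) = below (suc i) (s≤s z≤n)
    go (suc n) f       top below zero    = refl
    go (suc n) []      top below (suc i) = go n [] top (λ _ _ → refl) i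
    go (suc n) (a ∷ f) top below (suc i) = go n f top (λ j le → below (suc j) (s≤s le)) i

  -- To divide a + X f, divide `f`, multiply the result by X and add a. The remainder a + X r has
  -- degree at most d, and subtracting one multiple of `g` brings it below d.
  monic-division : ∀ {d} g → Monic d g → ∀ f → ∃ λ t → ∃ λ r → f ≐ g *P t +P r × DegreeBelow d r
  monic-division g monic []      = [] , [] , ≐-sym (≐-trans (+P.identityʳ _) (*P-zeroʳ g)) , λ _ _ → refl
  monic-division {d} g (top , below) (a ∷ f)
    with t , r , f≐ , br ← monic-division g (top , below) f =
    c ∷ t , (a ∷ r) +P negP (scaleP c g) , eq , bound
    where
    -- The coefficient of X^d in a + X r, which is also the constant term of the new quotient.
    c = coeff (a ∷ r) d

    eq : a ∷ f ≐ g *P (c ∷ t) +P ((a ∷ r) +P negP (scaleP c g))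
    eq = begin
      a ∷ f                                    ≈⟨ ∷-cong (sym (+-identityˡ a)) f≐ ⟩
      (0# ∷ (g *P t)) +P (a ∷ r)               ≈⟨ +P.identityʳ ((0# ∷ (g *P t)) +P (a ∷ r)) ⟨
      (0# ∷ (g *P t)) +P (a ∷ r) +P []
        ≈⟨ +P-cong {(0# ∷ (g *P t)) +P (a ∷ r)} ≐-refl (+P.inverseʳ (scaleP c g)) ⟨
      (0# ∷ (g *P t)) +P (a ∷ r) +P (scaleP c g +P negP (scaleP c g))
        ≈⟨ interchange (0# ∷ (g *P t)) (a ∷ r) (scaleP c g) (negP (scaleP c g)) ⟩
      ((0# ∷ (g *P t)) +P scaleP c g) +P ((a ∷ r) +P negP (scaleP c g))
        ≈⟨ +P-cong (≐-trans (+P.comm (0# ∷ (g *P t)) _) (≐-sym (*P-∷ g c t))) ≐-refl ⟩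
      g *P (c ∷ t) +P ((a ∷ r) +P negP (scaleP c g)) ∎

    coeff-r : ∀ i → coeff ((a ∷ r) +P negP (scaleP c g)) i ≡ coeff (a ∷ r) i + - (c * coeff g i)
    coeff-r i = trans (coeff-+ (a ∷ r) (negP (scaleP c g)) i)
      (cong (coeff (a ∷ r) i +_) (trans (coeff-neg (scaleP c g) i) (cong -_ (coeff-scale c g i))))

    bound : DegreeBelow d ((a ∷ r) +P negP (scaleP c g))
    bound i d≤i with ℕ.m≤n⇒m<n∨m≡n d≤i
    bound (suc i) _ | inj₁ d<i@(s≤s d≤i) = trans (coeff-r (suc i))
      (trans (cong₂ (λ x y → x + - y) (br i d≤i) (trans (cong (c *_) (below _ d<i)) (zeroʳ c)))
      (trans (+-identityˡ _) -0#≈0#))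
    ... | inj₂ refl = trans (coeff-r d)
      (trans (cong (λ x → c + - x) (trans (cong (c *_) top) (*-identityʳ c))) (-‿inverseʳ c))

-- The Cayley–Hamilton theorem

module CharacteristicPolynomial {q : ℕ} (F : FiniteField q) where
  open FiniteField F
  open FF F
  open Polynomials F
  open import Algebra.Properties.Semiring.Sum (CommutativeRing.semiring fieldRing)
  open Determinant fieldRing using (δ; sum-δ; sum-0; sum-linear)
  module ΣP where
    open import Algebra.Properties.Semiring.Sum (CommutativeRing.semiring polyRing) public
  open import Algebra.Properties.CommutativeSemigroup
    (CommutativeRing.+-commutativeSemigroup fieldRing) using (interchange)
  open import Algebra.Properties.CommutativeSemigroup
    (CommutativeRing.*-commutativeSemigroup fieldRing) using (x∙yz≈y∙xz)
  module Det = Determinant polyRing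
  open Det using (det; minor; signed; adjugate)

  lookup-removeAt : ∀ {A : Set} {n} (xs : Vec A (suc n)) j c →
    lookup (removeAt xs j) c ≡ lookup xs (punchIn j c)
  lookup-removeAt (x ∷ xs)     zero    c       = refl
  lookup-removeAt (x ∷ y ∷ xs) (suc j) zero    = refl
  lookup-removeAt (x ∷ y ∷ xs) (suc j) (suc c) = lookup-removeAt (y ∷ xs) j c

  sumP-tabulate : ∀ {n} (f : Fin n → Poly) → sumP (tabulate f) ≡ ΣP.sum f
  sumP-tabulate {zero}  f = refl
  sumP-tabulate {suc n} f = cong (f zero +P_) (sumP-tabulate (f ∘ suc))

  alt≡signed : ∀ n f → alt n f ≡ signed n f
  alt≡signed zero    f = refl
  alt≡signed (suc n) f = cong negP (alt≡signed n f)

  ≡⇒≐ : ∀ {f g : Poly} → f ≡ g → f ≐ g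
  ≡⇒≐ refl = ≐-refl

  detP≐det : ∀ {k} (M : Vec (Vec Poly k) k) → detP M ≐ det (λ i j → lookup (lookup M i) j)
  detP≐det {zero}  []           = ≐-refl
  detP≐det {suc k} (row ∷ rows) = ≐-trans (≡⇒≐ (sumP-tabulate λ j →
      alt (toℕ j) (lookup row j *P detP (Vec.map (λ r → removeAt r j) rows))))
    (ΣP.sum-cong-≋ λ j → ≐-trans
    (≡⇒≐ (alt≡signed (toℕ j) _))
    (Det.signed-cong (toℕ j) (*P-congˡ (lookup row j) (≐-trans
      (detP≐det (Vec.map (λ r → removeAt r j) rows))
      (Det.det-cong λ r c → ≡⇒≐ (trans
        (cong (λ v → lookup v c) (Vec.lookup-map r (λ r → removeAt r j) rows))
        (lookup-removeAt (lookup rows r) j c)))))))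

  SqMatrix : ℕ → Set
  SqMatrix k = Fin k → Fin k → Carrier

  charMatrix : ∀ {k} → SqMatrix k → Det.Matrix k
  charMatrix T i j = if does (i Fin.≟ j) then (- T i j) ∷ 1# ∷ [] else (- T i j) ∷ []

  χ : ∀ {k} → SqMatrix k → Poly
  χ T = det (charMatrix T)

  charPoly≐χ : ∀ {k} (T : Mat k) → charPoly T ≐ χ (entry T)
  charPoly≐χ {k} T = ≐-trans
    (detP≐det (tabulate λ i → tabulate (charMatrix (entry T) i)))
    (Det.det-cong λ i j → ≡⇒≐ (trans
    (cong (λ v → lookup v j) (Vec.lookup∘tabulate (λ i → tabulate (charMatrix (entry T) i)) i))
    (Vec.lookup∘tabulate (charMatrix (entry T) i) j)))

  degreeBelow-sum : ∀ {n m} (f : Fin n → Poly) → (∀ i → DegreeBelow m (f i)) → DegreeBelow m (ΣP.sum f)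
  degreeBelow-sum {zero}  f bf = λ _ _ → refl
  degreeBelow-sum {suc n} f bf = degreeBelow-+ (f zero) _ (bf zero) (degreeBelow-sum (f ∘ suc) (bf ∘ suc))

  degreeBelow-signed : ∀ n {m} f → DegreeBelow m f → DegreeBelow m (signed n f)
  degreeBelow-signed zero    f bf = bf
  degreeBelow-signed (suc n) f bf = degreeBelow-neg (signed n f) (degreeBelow-signed n f bf)

  laplaceTerm : ∀ {n} → Det.Matrix (suc n) → Fin (suc n) → Poly
  laplaceTerm A j = signed (toℕ j) (A zero j *P det (minor A j))

  degreeBelow-det : ∀ {n} (A : Det.Matrix n) → (∀ i j → DegreeBelow 2 (A i j)) → DegreeBelow (suc n) (det A)
  degreeBelow-det {zero}  A bA = λ { (suc i) _ → refl }
  degreeBelow-det {suc n} A bA = degreeBelow-sum (laplaceTerm A) λ j → degreeBelow-signed (toℕ j) (A zero j *P det (minor A j))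
    (degreeBelow-* (A zero j) _ (bA zero j) (degreeBelow-det (minor A j) λ r c → bA (suc r) (punchIn j c)))

  -- Each product in the full expansion takes exactly one entry from row `i`, so a constant row
  -- lowers the bound by one. It serves for minors of `charMatrix T` in which a row has lost its
  -- diagonal entry.
  degreeBelow-det-row : ∀ {n} (A : Det.Matrix n) i → (∀ i j → DegreeBelow 2 (A i j)) →
    (∀ j → DegreeBelow 1 (A i j)) → DegreeBelow n (det A)
  degreeBelow-det-row {suc n} A zero    bA bAᵢ = degreeBelow-sum (laplaceTerm A) λ j →
    degreeBelow-signed (toℕ j) (A zero j *P det (minor A j))
    (degreeBelow-* (A zero j) _ (bAᵢ j) (degreeBelow-det (minor A j) λ r c → bA (suc r) (punchIn j c)))
  degreeBelow-det-row {suc n} A (suc i) bA bAᵢ = degreeBelow-sum (laplaceTerm A) λ j →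
    degreeBelow-signed (toℕ j) (A zero j *P det (minor A j))
    (degreeBelow-* (A zero j) _ (bA zero j) (degreeBelow-det-row (minor A j) i
      (λ r c → bA (suc r) (punchIn j c)) (λ c → bAᵢ (punchIn j c))))

  charMatrix-degreeBelow : ∀ {k} (T : SqMatrix k) i j → DegreeBelow 2 (charMatrix T i j)
  charMatrix-degreeBelow T i j l 2≤l with does (i Fin.≟ j)
  charMatrix-degreeBelow T i j (suc (suc l)) _ | true  = refl
  charMatrix-degreeBelow T i j (suc l)       _ | false = refl
  charMatrix-degreeBelow T i j 1 (s≤s ()) | true

  charMatrix-offDiagonal : ∀ {k} (T : SqMatrix k) i j → i ≢ j → DegreeBelow 1 (charMatrix T i j)
  charMatrix-offDiagonal T i j i≢j (suc l) _ rewrite dec-false (i Fin.≟ j) i≢j = refl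

  -- Only the first term of the expansion reaches degree k + 1, and its minor is the characteristic
  -- matrix of the lower right block. In any other term the entry is constant and row `j` of the
  -- minor has lost its X with the deleted column.
  χ-monic : ∀ {k} (T : SqMatrix k) → Monic k (χ T)
  χ-monic {zero}  T = refl , λ { (suc i) _ → refl }
  χ-monic {suc k} T = top , degreeBelow-det (charMatrix T) (charMatrix-degreeBelow T)
    where
    A = charMatrix T
    term = laplaceTerm A

    rest : DegreeBelow (suc k) (ΣP.sum (term ∘ suc))
    rest = degreeBelow-sum (term ∘ suc) λ j →
      degreeBelow-signed (toℕ (suc j)) (A zero (suc j) *P det (minor A (suc j)))
        (degreeBelow-mono (A zero (suc j) *P det (minor A (suc j))) (ℕ.n≤1+n k)
          (degreeBelow-* (A zero (suc j)) (det (minor A (suc j)))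
            (charMatrix-offDiagonal T zero (suc j) λ ())
            (degreeBelow-det-row (minor A (suc j)) j
              (λ r c → charMatrix-degreeBelow T (suc r) (punchIn (suc j) c))
              (λ c → charMatrix-offDiagonal T (suc j) (punchIn (suc j) c) (Fin.punchInᵢ≢i (suc j) c ∘ sym)))))

    minor-monic = χ-monic (λ r c → T (suc r) (suc c))

    top : coeff (χ T) (suc k) ≡ 1#
    top = trans (coeff-+ (term zero) (ΣP.sum (term ∘ suc)) (suc k))
      (trans (cong₂ _+_
        (trans (coeff-*-top 1 k (A zero zero) (det (minor A zero)) (charMatrix-degreeBelow T zero zero)
                 (proj₂ minor-monic))
               (trans (*-identityˡ _) (proj₁ minor-monic)))
        (rest (suc k) ℕ.≤-refl))
      (+-identityʳ 1#))

  -- Row vectors as a module over the polynomials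

  V : ℕ → Set
  V k = Fin k → Carrier

  infix 4 _≋_
  _≋_ : ∀ {k} → V k → V k → Set
  u ≋ v = ∀ i → u i ≡ v i

  infixl 7 _·_
  -- With rows on the left, row `i` of the matrix product P T is `P i · T`; products of matrices are
  -- expressed in this way throughout.
  _·_ : ∀ {k} → V k → SqMatrix k → V k
  (w · T) j = sum λ i → w i * T i j

  ·-congˡ : ∀ {k} (T : SqMatrix k) {u v : V k} → u ≋ v → u · T ≋ v · T
  ·-congˡ T u≋v j = sum-cong-≗ λ i → cong (_* T i j) (u≋v i)

  ·-congʳ : ∀ {k} (w : V k) {S T : SqMatrix k} → (∀ i → S i ≋ T i) → w · S ≋ w · T
  ·-congʳ w S≋T j = sum-cong-≗ λ i → cong (w i *_) (S≋T i j)

  dot : ∀ {k} → V k → V k → Carrier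
  dot u v = sum λ i → u i * v i

  dot-linearˡ : ∀ {k} a b (u v w : V k) →
    dot (λ i → a * u i + b * v i) w ≡ a * dot u w + b * dot v w
  dot-linearˡ a b u v w = trans
    (sum-cong-≗ λ i → trans (distribʳ (w i) _ _) (cong₂ _+_ (*-assoc a _ _) (*-assoc b _ _)))
    (sum-linear a b (λ i → u i * w i) (λ i → v i * w i))

  ·-linear : ∀ {k} (T : SqMatrix k) a b u v →
    (λ i → a * u i + b * v i) · T ≋ λ j → a * (u · T) j + b * (v · T) j
  ·-linear T a b u v j = dot-linearˡ a b u v (λ i → T i j)

  δ-sum : ∀ {k} (f : V k) i → sum (λ j → δ i j * f j) ≡ f i
  δ-sum {suc k} f zero    = trans (cong₂ _+_ (*-identityˡ _) (sum-0 λ j → zeroˡ (f (suc j)))) (+-identityʳ _)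
  δ-sum {suc k} f (suc i) = trans (cong₂ _+_ (zeroˡ _) (δ-sum (f ∘ suc) i)) (+-identityˡ _)

  0ᵛ : ∀ {k} → V k
  0ᵛ _ = 0#

  module _ {k} (T : SqMatrix k) where
    -- w · f(T)
    eval : Poly → V k → V k
    eval []      w i = 0#
    eval (a ∷ f) w i = a * w i + eval f (w · T) i

    eval-congᵛ : ∀ f {u v} → u ≋ v → eval f u ≋ eval f v
    eval-congᵛ []      u≋v i = refl
    eval-congᵛ (a ∷ f) u≋v i =
      cong₂ _+_ (cong (a *_) (u≋v i)) (eval-congᵛ f (·-congˡ T u≋v) i)

    eval-linear : ∀ f a b u v → eval f (λ i → a * u i + b * v i) ≋ λ i → a * eval f u i + b * eval f v i
    eval-linear []      a b u v i = sym (trans (cong₂ _+_ (zeroʳ a) (zeroʳ b)) (+-identityˡ 0#))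
    eval-linear (c ∷ f) a b u v i = begin
      c * (a * u i + b * v i) + eval f ((λ i → a * u i + b * v i) · T) i
        ≡⟨ cong₂ _+_ (trans (distribˡ c _ _) (cong₂ _+_ (x∙yz≈y∙xz c a _) (x∙yz≈y∙xz c b _)))
             (trans (eval-congᵛ f (·-linear T a b u v) i) (eval-linear f a b (u · T) (v · T) i)) ⟩
      (a * (c * u i) + b * (c * v i)) + (a * eval f (u · T) i + b * eval f (v · T) i)
        ≡⟨ interchange _ _ _ _ ⟩
      (a * (c * u i) + a * eval f (u · T) i) + (b * (c * v i) + b * eval f (v · T) i)
        ≡⟨ cong₂ _+_ (distribˡ a _ _) (distribˡ b _ _) ⟨
      a * (c * u i + eval f (u · T) i) + b * (c * v i + eval f (v · T) i) ∎
      where open ≡-Reasoning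

    eval-0ᵛ : ∀ f → eval f 0ᵛ ≋ 0ᵛ
    eval-0ᵛ []      i = refl
    eval-0ᵛ (a ∷ f) i = trans (cong₂ _+_ (zeroʳ a)
      (trans (eval-congᵛ f (λ j → sum-0 λ i → zeroˡ (T i j)) i) (eval-0ᵛ f i))) (+-identityˡ 0#)

    eval-sumᵛ : ∀ f {n} (x : Fin n → Carrier) (u : Fin n → V k) →
      eval f (λ c → sum λ i → x i * u i c) ≋ λ c → sum λ i → x i * eval f (u i) c
    eval-sumᵛ f {zero}  x u c = eval-0ᵛ f c
    eval-sumᵛ f {suc n} x u c = begin
      eval f (λ c → x zero * u zero c + sum (λ i → x (suc i) * u (suc i) c)) c
        ≡⟨ eval-congᵛ f (λ c → cong (x zero * u zero c +_) (sym (*-identityˡ _))) c ⟩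
      eval f (λ c → x zero * u zero c + 1# * sum (λ i → x (suc i) * u (suc i) c)) c
        ≡⟨ eval-linear f (x zero) 1# (u zero) _ c ⟩
      x zero * eval f (u zero) c + 1# * eval f (λ c → sum (λ i → x (suc i) * u (suc i) c)) c
        ≡⟨ cong (x zero * eval f (u zero) c +_) (trans (*-identityˡ _) (eval-sumᵛ f (x ∘ suc) (u ∘ suc) c)) ⟩
      x zero * eval f (u zero) c + sum (λ i → x (suc i) * eval f (u (suc i)) c) ∎
      where open ≡-Reasoning

    eval-· : ∀ f w → eval f w · T ≋ eval f (w · T)
    eval-· []      w j = sum-0 λ i → zeroˡ (T i j)
    eval-· (a ∷ f) w j = begin
      ((λ i → a * w i + eval f (w · T) i) · T) j
        ≡⟨ ·-congˡ T (λ i → cong (a * w i +_) (sym (*-identityˡ _))) j ⟩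
      ((λ i → a * w i + 1# * eval f (w · T) i) · T) j
        ≡⟨ ·-linear T a 1# w (eval f (w · T)) j ⟩
      a * (w · T) j + 1# * (eval f (w · T) · T) j
        ≡⟨ cong (a * (w · T) j +_) (trans (*-identityˡ _) (eval-· f (w · T) j)) ⟩
      a * (w · T) j + eval f (w · T · T) j ∎
      where open ≡-Reasoning

    eval-+ : ∀ f g w → eval (f +P g) w ≋ λ i → eval f w i + eval g w i
    eval-+ []      g       w i = sym (+-identityˡ _)
    eval-+ (a ∷ f) []      w i = sym (+-identityʳ _)
    eval-+ (a ∷ f) (b ∷ g) w i = trans
      (cong₂ _+_ (distribʳ (w i) a b) (eval-+ f g (w · T) i)) (interchange _ _ _ _)

    eval-scale : ∀ a f w → eval (scaleP a f) w ≋ λ i → a * eval f w i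
    eval-scale a []      w i = sym (zeroʳ a)
    eval-scale a (b ∷ f) w i = trans
      (cong₂ _+_ (*-assoc a b (w i)) (eval-scale a f (w · T) i)) (sym (distribˡ a _ _))

    eval-[] : ∀ {f} → f ≐ [] → ∀ w → eval f w ≋ 0ᵛ
    eval-[] {[]}    f≐ w i = refl
    eval-[] {a ∷ f} f≐ w i = trans (cong₂ _+_ (trans (cong (_* w i) (coeff-≡ f≐ 0)) (zeroˡ (w i)))
      (eval-[] {f} (tail-≐[] f≐) (w · T) i)) (+-identityˡ 0#)

    eval-cong : ∀ {f g} → f ≐ g → ∀ w → eval f w ≋ eval g w
    eval-cong {f}     {[]}    f≐g w i = eval-[] f≐g w i
    eval-cong {[]}    {b ∷ g} f≐g w i = sym (eval-[] (≐-sym f≐g) w i)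
    eval-cong {a ∷ f} {b ∷ g} f≐g w i =
      cong₂ _+_ (cong (_* w i) (coeff-≡ f≐g 0)) (eval-cong (tail-≐ f≐g) (w · T) i)

    -- The module law for X acting as `T`. It rests on `eval-·`, by which the action of `g` commutes
    -- with `T`.
    eval-* : ∀ f g w → eval (f *P g) w ≋ eval f (eval g w)
    eval-* []      g w i = refl
    eval-* (a ∷ f) g w i = begin
      eval (scaleP a g +P (0# ∷ (f *P g))) w i
        ≡⟨ eval-+ (scaleP a g) (0# ∷ (f *P g)) w i ⟩
      eval (scaleP a g) w i + (0# * w i + eval (f *P g) (w · T) i)
        ≡⟨ cong₂ _+_ (eval-scale a g w i)
             (trans (cong (_+ eval (f *P g) (w · T) i) (zeroˡ (w i))) (+-identityˡ _)) ⟩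
      a * eval g w i + eval (f *P g) (w · T) i
        ≡⟨ cong (a * eval g w i +_) (trans (eval-* f g (w · T) i) (eval-congᵛ f (sym ∘ eval-· g w) i)) ⟩
      a * eval g w i + eval f (eval g w · T) i ∎
      where open ≡-Reasoning

    eval-sum : ∀ {n} (f : Fin n → Poly) w → eval (ΣP.sum f) w ≋ λ c → sum λ i → eval (f i) w c
    eval-sum {zero}  f w c = refl
    eval-sum {suc n} f w c = trans (eval-+ (f zero) (ΣP.sum (f ∘ suc)) w c)
      (cong (eval (f zero) w c +_) (eval-sum (f ∘ suc) w c))

    eval-charMatrix : ∀ i j w c → eval (charMatrix T i j) w c ≡ - T i j * w c + δ i j * (w · T) c
    eval-charMatrix i j w c with does (i Fin.≟ j)
    ... | true  = cong (- T i j * w c +_) (+-identityʳ _)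
    ... | false = cong (- T i j * w c +_) (sym (zeroˡ _))

    -- The `i`-th equation of the system X I - T at the unit vectors: X sends e_i to row `i` of `T`,
    -- which is the sum of the T_ij e_j.
    charMatrix-annihilates : ∀ i c → sum (λ j → eval (charMatrix T i j) (δ j) c) ≡ 0#
    charMatrix-annihilates i c = begin
      sum (λ j → eval (charMatrix T i j) (δ j) c)
        ≡⟨ sum-cong-≗ (λ j → eval-charMatrix i j (δ j) c) ⟩
      sum (λ j → - T i j * δ j c + δ i j * (δ j · T) c)
        ≡⟨ ∑-distrib-+ (λ j → - T i j * δ j c) (λ j → δ i j * (δ j · T) c) ⟩
      sum (λ j → - T i j * δ j c) + sum (λ j → δ i j * (δ j · T) c)
        ≡⟨ cong₂ _+_ (sum-δ (λ j → - T i j) c) (trans (δ-sum (λ j → (δ j · T) c) i) (δ-sum (λ j → T j c) i)) ⟩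
      - T i c + T i c
        ≡⟨ -‿inverseˡ (T i c) ⟩
      0# ∎
      where open ≡-Reasoning

    eval-δP : ∀ (i j : Fin k) f w c → eval (f *P Det.δ i j) w c ≡ δ i j * eval f w c
    eval-δP i j f w c with does (i Fin.≟ j)
    ... | true  = trans (eval-cong (≐-trans (*P-comm f oneP) (*P-identityˡ f)) w c) (sym (*-identityˡ _))
    ... | false = trans (eval-cong (*P-zeroʳ f) w c) (sym (zeroˡ _))

    -- The vectors e_j satisfy the linear system charMatrix T, so its determinant annihilates them.
    cayley-hamilton-basis : ∀ j → eval (χ T) (δ j) ≋ 0ᵛ
    cayley-hamilton-basis j c = begin
      eval (χ T) (δ j) c
        ≡⟨ δ-sum (λ k → eval (χ T) (δ k) c) j ⟨
      sum (λ k → δ j k * eval (χ T) (δ k) c)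
        ≡⟨ sum-cong-≗ {k} (λ k → eval-δP j k (χ T) (δ k) c) ⟨
      sum (λ k → eval (χ T *P Det.δ j k) (δ k) c)
        ≡⟨ sum-cong-≗ {k} (λ k → eval-cong (Det.adjugate-inverseˡ A j k) (δ k) c) ⟨
      sum (λ k → eval (ΣP.sum (λ i → adjugate A j i *P A i k)) (δ k) c)
        ≡⟨ sum-cong-≗ (λ k → eval-sum (λ i → adjugate A j i *P A i k) (δ k) c) ⟩
      sum (λ k → sum λ i → eval (adjugate A j i *P A i k) (δ k) c)
        -- After the exchange, `adjugate A j i` acts on the whole `i`-th equation of the system,
        -- which is zero.
        ≡⟨ ∑-comm (λ k i → eval (adjugate A j i *P A i k) (δ k) c) ⟩
      sum (λ i → sum λ k → eval (adjugate A j i *P A i k) (δ k) c)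
        ≡⟨ sum-0 row ⟩
      0# ∎
      where
      open ≡-Reasoning
      A = charMatrix T

      row : ∀ i → sum (λ k → eval (adjugate A j i *P A i k) (δ k) c) ≡ 0#
      row i = begin
        sum (λ k → eval (adjugate A j i *P A i k) (δ k) c)
          ≡⟨ sum-cong-≗ (λ k → trans (eval-* (adjugate A j i) (A i k) (δ k) c) (sym (*-identityˡ _))) ⟩
        sum (λ k → 1# * eval (adjugate A j i) (eval (A i k) (δ k)) c)
          ≡⟨ eval-sumᵛ (adjugate A j i) (λ _ → 1#) (λ k → eval (A i k) (δ k)) c ⟨
        eval (adjugate A j i) (λ c → sum λ k → 1# * eval (A i k) (δ k) c) c
          ≡⟨ eval-congᵛ (adjugate A j i) (λ c → trans (sum-cong-≗ (λ k → *-identityˡ (eval (A i k) (δ k) c)))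
               (charMatrix-annihilates i c)) c ⟩
        eval (adjugate A j i) 0ᵛ c
          ≡⟨ eval-0ᵛ (adjugate A j i) c ⟩
        0# ∎

    cayley-hamilton : ∀ w → eval (χ T) w ≋ 0ᵛ
    cayley-hamilton w c = begin
      eval (χ T) w c                              ≡⟨ eval-congᵛ (χ T) (λ j → sym (sum-δ w j)) c ⟩
      eval (χ T) (λ c → sum λ j → w j * δ j c) c  ≡⟨ eval-sumᵛ (χ T) w δ c ⟩
      sum (λ j → w j * eval (χ T) (δ j) c)
        ≡⟨ sum-0 (λ j → trans (cong (w j *_) (cayley-hamilton-basis j c)) (zeroʳ (w j))) ⟩
      0#                                          ∎
      where open ≡-Reasoning

-- Cyclic vectors

module CyclicVectors {q : ℕ} (F : FiniteField q) where
  open FiniteField F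
  open FF F
  open Polynomials F
  open CharacteristicPolynomial F
  open import Algebra.Properties.Semiring.Sum (CommutativeRing.semiring fieldRing)
  open Determinant fieldRing using (δ; sum-δ; sum-0)

  ·-assoc : ∀ {k} (w : V k) (S T : SqMatrix k) → w · S · T ≋ w · (λ i → S i · T)
  ·-assoc w S T j = begin
    sum (λ l → sum (λ i → w i * S i l) * T l j)
      ≡⟨ sum-cong-≗ (λ l → *-distribʳ-sum (T l j) (λ i → w i * S i l)) ⟩
    sum (λ l → sum λ i → w i * S i l * T l j)
      ≡⟨ ∑-comm (λ l i → w i * S i l * T l j) ⟩
    sum (λ i → sum λ l → w i * S i l * T l j)
      ≡⟨ sum-cong-≗ (λ i → trans (sum-cong-≗ λ l → *-assoc (w i) (S i l) (T l j))
           (sym (*-distribˡ-sum (w i) (λ l → S i l * T l j)))) ⟩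
    sum (λ i → w i * sum (λ l → S i l * T l j)) ∎
    where open ≡-Reasoning

  -- Linear independence of the rows of `P`, stated for the map u ↦ u P.
  Injective : ∀ {k} → SqMatrix k → Set
  Injective P = ∀ {u v} → u · P ≋ v · P → u ≋ v

  Invertible : ∀ {k} → SqMatrix k → Set
  Invertible P = ∃ λ N → (∀ i → P i · N ≋ δ i) × (∀ i → N i · P ≋ δ i)

  invertible⇒injective : ∀ {k} {P : SqMatrix k} → Invertible P → Injective P
  invertible⇒injective {k} {P} (N , PN , NP) {u} {v} uP≋vP i = begin
    u i            ≡⟨ expand u i ⟩
    (u · P · N) i  ≡⟨ ·-congˡ N uP≋vP i ⟩
    (v · P · N) i  ≡⟨ expand v i ⟨
    v i            ∎
    where
    open ≡-Reasoning
    expand : ∀ w → w ≋ w · P · N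
    expand w i = sym (trans (·-assoc w P N i) (trans (·-congʳ w PN i) (sum-δ w i)))

  finite-field : Finite Carrier q
  finite-field = elements , elements-unique , elements-length , λ x → mk⇔ _ λ _ → elements-complete x

  -- On finitely many vectors injective means surjective, and preimages of the unit vectors are the
  -- rows of `N` with N P = I. Then (P N) P = P = I P, and injectivity cancels `P`. Vectors pass
  -- through `Vec` because it has an enumeration and decidable equality.
  injective⇒invertible : ∀ {k} {P : SqMatrix k} → Injective P → Invertible P
  injective⇒invertible {k} {P} inj = N , PN , NP
    where
    apply : Vec Carrier k → Vec Carrier k
    apply v = tabulate (lookup v · P)

    lookup-apply : ∀ v → lookup (apply v) ≋ lookup v · P
    lookup-apply v = Vec.lookup∘tabulate (lookup v · P)

    apply-injective : ∀ {u v} → apply u ≡ apply v → u ≡ v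
    apply-injective {u} {v} eq = trans (sym (Vec.tabulate∘lookup u)) (trans
      (Vec.tabulate-cong (inj λ i → trans (sym (lookup-apply u i))
        (trans (cong (λ w → lookup w i) eq) (lookup-apply v i))))
      (Vec.tabulate∘lookup v))

    preimage : ∀ i → ∃ λ v → apply v ≡ tabulate (δ i)
    preimage i = injective⇒surjective (finite-vec finite-field k) (Vec.≡-dec _≟_) apply apply-injective (tabulate (δ i))

    N : SqMatrix k
    N i = lookup (proj₁ (preimage i))

    NP : ∀ i → N i · P ≋ δ i
    NP i j = trans (sym (lookup-apply (proj₁ (preimage i)) j))
      (trans (cong (λ w → lookup w j) (proj₂ (preimage i))) (Vec.lookup∘tabulate (δ i) j))

    PN : ∀ i → P i · N ≋ δ i
    PN i = inj λ j → trans (·-assoc (P i) N P j)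
      (trans (·-congʳ (P i) NP j) (trans (sum-δ (P i) j) (sym (δ-sum (λ l → P l j) i))))

  -- The vector w T^n, with `T` applied to `w` first, in the order in which `eval` recurses.
  power : ∀ {k} → SqMatrix k → ℕ → V k → V k
  power T zero    w = w
  power T (suc n) w = power T n (w · T)

  krylov : ∀ {k} → SqMatrix k → V k → SqMatrix k
  krylov T w i = power T (toℕ i) w

  power-cong : ∀ {k} {S T : SqMatrix k} → (∀ i → S i ≋ T i) → ∀ n w → power S n w ≋ power T n w
  power-cong         S≋T zero    w j = refl
  power-cong {S = S} {T} S≋T (suc n) w j = trans (power-congᵛ n (·-congʳ w S≋T) j) (power-cong S≋T n (w · T) j)
    where
    power-congᵛ : ∀ n {u v} → u ≋ v → power S n u ≋ power S n v
    power-congᵛ zero    u≋v = u≋v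
    power-congᵛ (suc n) u≋v = power-congᵛ n (·-congˡ S u≋v)

  power-suc : ∀ {k} (T : SqMatrix k) n w → power T (suc n) w ≋ power T n w · T
  power-suc T zero    w i = refl
  power-suc T (suc n) w i = power-suc T n (w · T) i

  eval-toList : ∀ {k} (T : SqMatrix k) {n} (cs : Vec Carrier n) w j →
    eval T (toList cs) w j ≡ sum λ i → lookup cs i * power T (toℕ i) w j
  eval-toList T []       w j = refl
  eval-toList T (c ∷ cs) w j = cong (c * w j +_) (eval-toList T cs (w · T) j)

  eval-monicPoly : ∀ {k} (T : SqMatrix k) {n} (cs : Vec Carrier n) w j →
    eval T (monicPoly cs) w j ≡ sum (λ i → lookup cs i * power T (toℕ i) w j) + power T n w j
  eval-monicPoly T []       w j = trans (+-identityʳ _) (trans (*-identityˡ _) (sym (+-identityˡ _)))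
  eval-monicPoly T (c ∷ cs) w j = trans (cong (c * w j +_) (eval-monicPoly T cs (w · T) j)) (sym (+-assoc _ _ _))

  open import Algebra.Properties.Group (CommutativeRing.+-group fieldRing)
    using () renaming (∙-cancelʳ to +-cancelʳ; inverseʳ-unique to +-inverseʳ-unique)

  -- The rows w T^i are independent, so w T^k has only one expansion in them; up to sign its
  -- coefficients are the lower coefficients of any monic annihilator of degree k.
  annihilator-unique : ∀ {k} (T : SqMatrix k) w → Injective (krylov T w) → ∀ f g →
    Monic k f → Monic k g → eval T f w ≋ 0ᵛ → eval T g w ≋ 0ᵛ → f ≐ g
  annihilator-unique {k} T w inj f g mf mg fw gw = ≐-trans (monic⇒≐ k f mf)
    (≐-trans (≡⇒≐ (cong monicPoly (Vec.tabulate-cong cs≋ds))) (≐-sym (monic⇒≐ k g mg)))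
    where
    expand : ∀ h → Monic k h → eval T h w ≋ 0ᵛ → ∀ j →
      ((coeff h ∘ toℕ) · krylov T w) j + power T k w j ≡ 0#
    expand h mh hw j = begin
      ((coeff h ∘ toℕ) · krylov T w) j + power T k w j
        ≡⟨ cong (_+ power T k w j) (sum-cong-≗ λ i →
             cong (_* krylov T w i j) (Vec.lookup∘tabulate (coeff h ∘ toℕ) i)) ⟨
      sum (λ i → lookup (coefficients k h) i * krylov T w i j) + power T k w j
        ≡⟨ eval-monicPoly T (coefficients k h) w j ⟨
      eval T (monicPoly (coefficients k h)) w j
        ≡⟨ eval-cong T (monic⇒≐ k h mh) w j ⟨
      eval T h w j
        ≡⟨ hw j ⟩
      0# ∎
      where open ≡-Reasoning

    cs≋ds : (coeff f ∘ toℕ) ≋ (coeff g ∘ toℕ)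
    cs≋ds = inj λ j → +-cancelʳ (power T k w j) _ _ (trans (expand f mf fw j) (sym (expand g mg gw j)))

  neg : ∀ {k} → V k → V k
  neg c i = - c i

  neg-· : ∀ {k} (c : V k) (P : SqMatrix k) j → (neg c · P) j ≡ - (c · P) j
  neg-· c P j = +-inverseʳ-unique _ _ (begin
    (c · P) j + (neg c · P) j                    ≡⟨ ∑-distrib-+ (λ i → c i * P i j) (λ i → - c i * P i j) ⟨
    sum (λ i → c i * P i j + - c i * P i j)      ≡⟨ sum-0 (λ i → trans (sym (distribʳ (P i j) (c i) (- c i)))
                                                      (trans (cong (_* P i j) (-‿inverseʳ (c i))) (zeroˡ (P i j)))) ⟩
    0#                                           ∎)
    where open ≡-Reasoning

  module _ {k} (T : SqMatrix k) (w : V k) (w≢0 : ¬ (w ≋ 0ᵛ)) (irr : Irreducible (χ T)) where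
    -- By irreducibility one factor is constant. If it is `g`, then g = 1 and `w` would be zero; if
    -- it is `t`, then `χ T` would have degree at most d, which is below k.
    monic-divisor-of-χ-nonannihilating : ∀ {d} g t → d ℕ.< k → Monic d g → g *P t ≐ χ T → ¬ (eval T g w ≋ 0ᵛ)
    monic-divisor-of-χ-nonannihilating {d} g t d<k mg gt≐χ gw with proj₂ irr g t (≐⇒≈P gt≐χ)
    ... | inj₁ deg≡0 = w≢0 λ i → begin
      w i              ≡⟨ trans (+-identityʳ _) (*-identityˡ _) ⟨
      eval T oneP w i
        ≡⟨ eval-cong T (monic⇒≐ 0 g (subst (λ d → Monic d g) (trans (sym (deg-monic {f = g} mg)) deg≡0) mg)) w i ⟨
      eval T g w i     ≡⟨ gw i ⟩
      0#               ∎
      where open ≡-Reasoning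
    ... | inj₂ deg≡0 = monic-nonzero {f = χ T} (χ-monic T)
      (degreeBelow-cong (≐-trans (*P-comm t g) gt≐χ)
        (degreeBelow-* {0} t g (deg≡0⇒degreeBelow t deg≡0) (proj₂ mg)) k d<k)

    -- Descent on the degree bound. A nonzero `f`, made monic, divides `χ T`: the remainder also
    -- kills `w` by Cayley-Hamilton and is zero by induction. Such a divisor has just been excluded.
    annihilator-zero : ∀ d → d ℕ.≤ k → ∀ f → DegreeBelow d f → eval T f w ≋ 0ᵛ → f ≐ []
    annihilator-zero zero    d≤k f bf fw = degreeBelow-0 bf
    annihilator-zero (suc d) d<k f bf fw with leading f
    ... | inj₁ f≐[] = f≐[]
    ... | inj₂ (e , _ , top , be) = contradiction gw
      (monic-divisor-of-χ-nonannihilating g t (ℕ.≤-trans (s≤s e≤d) d<k) mg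
        (≐-sym (≐-trans χ≐ (≐-trans (+P-cong ≐-refl r≐[]) (+P-identityʳ (g *P t))))))
      where
      e≤d : e ℕ.≤ d
      e≤d = s≤s⁻¹ (ℕ.≰⇒> λ d<e → top (bf e d<e))

      a = proj₁ (inverse (coeff f e) top)
      g = scaleP a f

      mg : Monic e g
      mg = trans (coeff-scale a f e) (trans (*-comm a _) (proj₂ (inverse (coeff f e) top))) ,
        λ i le → trans (coeff-scale a f i) (trans (cong (a *_) (be i le)) (zeroʳ a))

      gw : eval T g w ≋ 0ᵛ
      gw i = trans (eval-scale T a f w i) (trans (cong (a *_) (fw i)) (zeroʳ a))

      division = monic-division g mg (χ T)
      t = proj₁ division
      r = proj₁ (proj₂ division)
      χ≐ = proj₁ (proj₂ (proj₂ division))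

      rw : eval T r w ≋ 0ᵛ
      rw i = begin
        eval T r w i                         ≡⟨ +-identityˡ _ ⟨
        0# + eval T r w i                    ≡⟨ cong (_+ eval T r w i) gtw ⟨
        eval T (g *P t) w i + eval T r w i   ≡⟨ eval-+ T (g *P t) r w i ⟨
        eval T (g *P t +P r) w i             ≡⟨ eval-cong T χ≐ w i ⟨
        eval T (χ T) w i                     ≡⟨ cayley-hamilton T w i ⟩
        0#                                   ∎
        where
        open ≡-Reasoning
        gtw : eval T (g *P t) w i ≡ 0#
        gtw = trans (eval-cong T (*P-comm g t) w i) (trans (eval-* T t g w i)
          (trans (eval-congᵛ T t gw i) (eval-0ᵛ T t i)))

      r≐[] : r ≐ []
      r≐[] = annihilator-zero d (ℕ.<⇒≤ d<k) r
        (degreeBelow-mono r e≤d (proj₂ (proj₂ (proj₂ division)))) rw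

    -- A relation u P = v P says that the polynomial with coefficients u - v, of degree below k,
    -- annihilates `w`.
    krylov-injective : Injective (krylov T w)
    krylov-injective {u} {v} uP≋vP i = begin
      u i                   ≡⟨ +-identityʳ _ ⟨
      u i + 0#              ≡⟨ cong (u i +_) (-‿inverseˡ (v i)) ⟨
      u i + (- v i + v i)   ≡⟨ +-assoc _ _ _ ⟨
      u i + - v i + v i     ≡⟨ cong (_+ v i) (difference-0 i) ⟩
      0# + v i              ≡⟨ +-identityˡ _ ⟩
      v i                   ∎
      where
      open ≡-Reasoning
      difference : Vec Carrier k
      difference = tabulate λ i → u i + - v i

      annihilates : eval T (toList difference) w ≋ 0ᵛ
      annihilates j = begin
        eval T (toList difference) w j
          ≡⟨ eval-toList T difference w j ⟩
        sum (λ i → lookup difference i * krylov T w i j)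
          ≡⟨ sum-cong-≗ (λ i → trans (cong (_* krylov T w i j) (Vec.lookup∘tabulate (λ i → u i + - v i) i))
               (distribʳ (krylov T w i j) (u i) (- v i))) ⟩
        sum (λ i → u i * krylov T w i j + - v i * krylov T w i j)
          ≡⟨ ∑-distrib-+ (λ i → u i * krylov T w i j) (λ i → - v i * krylov T w i j) ⟩
        (u · krylov T w) j + (neg v · krylov T w) j
          ≡⟨ cong₂ _+_ (uP≋vP j) (neg-· v (krylov T w) j) ⟩
        (v · krylov T w) j + - (v · krylov T w) j
          ≡⟨ -‿inverseʳ _ ⟩
        0# ∎

      bound : ∀ {n} (cs : Vec Carrier n) → DegreeBelow n (toList cs)
      bound []       i       _        = refl
      bound (c ∷ cs) (suc i) (s≤s le) = bound cs i le

      difference-0 : ∀ i → u i + - v i ≡ 0#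
      difference-0 i = begin
        u i + - v i                         ≡⟨ Vec.lookup∘tabulate (λ i → u i + - v i) i ⟨
        lookup difference i                 ≡⟨ coeff-toList difference i ⟨
        coeff (toList difference) (toℕ i)   ≡⟨ coeff-≡ (annihilator-zero k ℕ.≤-refl (toList difference) (bound difference) annihilates) (toℕ i) ⟩
        0#                                  ∎

  -- Companion matrices and bases adapted to them

  -- The two tests are those of `tsr`, so that for m = 1 the entries agree once block indices are
  -- replaced by plain ones.
  companion : ∀ {k} → V k → SqMatrix k
  companion {k} c i j =
    if does (suc (toℕ j) ℕ.≟ k) then c i
    else if does (toℕ i ℕ.≟ suc (toℕ j)) then 1# else 0#

  transpose : ∀ {k} → SqMatrix k → SqMatrix k
  transpose T i j = T j i

  companion-last : ∀ {k} (c : V (suc k)) → transpose (companion c) (fromℕ k) ≋ c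
  companion-last {k} c j rewrite Fin.toℕ-fromℕ k | dec-true (suc k ℕ.≟ suc k) refl = refl

  companion-shift : ∀ {k} (c : V (suc k)) (i : Fin k) → transpose (companion c) (inject₁ i) ≋ δ (suc i)
  companion-shift {k} c i j
    rewrite Fin.toℕ-inject₁ i
          | dec-false (suc (toℕ i) ℕ.≟ suc k) (ℕ.<⇒≢ (Fin.toℕ<n i) ∘ ℕ.suc-injective)
    with suc i Fin.≟ j
  ... | yes refl  rewrite dec-true (toℕ j ℕ.≟ suc (toℕ i)) refl = refl
  ... | no  i+1≢j rewrite dec-false (toℕ j ℕ.≟ suc (toℕ i)) (i+1≢j ∘ sym ∘ Fin.toℕ-injective) = refl

  -- Row i of P is mapped to row i + 1 by T, and the last row to the combination c of the rows.
  record CompanionBasis {k} (P T : SqMatrix k) (c : V k) : Set where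
    constructor companionBasis
    field row-image : ∀ i → P i · T ≋ transpose (companion c) i · P
  open CompanionBasis

  module _ {k} {P T : SqMatrix (suc k)} {c : V (suc k)} (basis : CompanionBasis P T c) where
    companionBasis-shift : ∀ (i : Fin k) → P (inject₁ i) · T ≋ P (suc i)
    companionBasis-shift i j = begin
      (P (inject₁ i) · T) j                            ≡⟨ row-image basis (inject₁ i) j ⟩
      (transpose (companion c) (inject₁ i) · P) j      ≡⟨ ·-congˡ P (companion-shift c i) j ⟩
      (δ (suc i) · P) j                                ≡⟨ δ-sum (λ l → P l j) (suc i) ⟩
      P (suc i) j                                      ∎
      where open ≡-Reasoning

    -- The exponent is a separate variable because the recursive call is at `inject₁ i`, which is
    -- not structurally smaller than `suc i`.
    companionBasis-power : ∀ n i → toℕ i ≡ n → power T n (P zero) ≋ P i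
    companionBasis-power zero    zero    _  j = refl
    companionBasis-power (suc n) (suc i) eq j = begin
      power T (suc n) (P zero) j       ≡⟨ power-suc T n (P zero) j ⟩
      (power T n (P zero) · T) j
        ≡⟨ ·-congˡ T (companionBasis-power n (inject₁ i) (trans (Fin.toℕ-inject₁ i) (ℕ.suc-injective eq))) j ⟩
      (P (inject₁ i) · T) j            ≡⟨ companionBasis-shift i j ⟩
      P (suc i) j                      ∎
      where open ≡-Reasoning

    companionBasis-krylov : ∀ i → krylov T (P zero) i ≋ P i
    companionBasis-krylov i = companionBasis-power (toℕ i) i refl

    companionBasis-top : power T (suc k) (P zero) ≋ c · P
    companionBasis-top j = begin
      power T (suc k) (P zero) j              ≡⟨ power-suc T k (P zero) j ⟩
      (power T k (P zero) · T) j              ≡⟨ ·-congˡ T (companionBasis-power k (fromℕ k) (Fin.toℕ-fromℕ k)) j ⟩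
      (P (fromℕ k) · T) j                     ≡⟨ row-image basis (fromℕ k) j ⟩
      (transpose (companion c) (fromℕ k) · P) j ≡⟨ ·-congˡ P (companion-last c) j ⟩
      (c · P) j                               ∎
      where open ≡-Reasoning

  companionBasis-annihilates : ∀ {k} {P T : SqMatrix (suc k)} (cs : Vec Carrier (suc k)) →
    CompanionBasis P T (neg (lookup cs)) → eval T (monicPoly cs) (P zero) ≋ 0ᵛ
  companionBasis-annihilates {k} {P} {T} cs basis j = begin
    eval T (monicPoly cs) (P zero) j
      ≡⟨ eval-monicPoly T cs (P zero) j ⟩
    (lookup cs · krylov T (P zero)) j + power T (suc k) (P zero) j
      ≡⟨ cong₂ _+_ (·-congʳ (lookup cs) (companionBasis-krylov basis) j)
           (trans (companionBasis-top basis j) (neg-· (lookup cs) P j)) ⟩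
    (lookup cs · P) j + - (lookup cs · P) j
      ≡⟨ -‿inverseʳ _ ⟩
    0# ∎
    where open ≡-Reasoning

  -- The first row of `P` is cyclic for `T`, so its monic annihilator of degree k + 1 is unique. The
  -- polynomial `f` is left open: it is χ of `T` in one use and χ of the transpose of `T` in
  -- `χ-companion`.
  companionBasis-χ : ∀ {k} {P T : SqMatrix (suc k)} (cs : Vec Carrier (suc k)) → Injective P →
    CompanionBasis P T (neg (lookup cs)) →
    ∀ f → Monic (suc k) f → eval T f (P zero) ≋ 0ᵛ → f ≐ monicPoly cs
  companionBasis-χ {k} {P} {T} cs inj basis f mf fP =
    annihilator-unique T (P zero) krylov-inj f (monicPoly cs) mf (monicPoly-monic cs) fP
      (companionBasis-annihilates cs basis)
    where
    krylov-inj : Injective (krylov T (P zero))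
    krylov-inj {u} {v} eq = inj λ j → trans
      (·-congʳ u (λ i j → sym (companionBasis-krylov basis i j)) j)
      (trans (eq j) (·-congʳ v (companionBasis-krylov basis) j))

  -- All rows but the last are shifts by construction. For the last one Cayley-Hamilton expresses w
  -- T^(k+1) by the lower powers, whence the negated coefficients.
  krylov-companionBasis : ∀ {k} (T : SqMatrix (suc k)) w →
    CompanionBasis (krylov T w) T (neg (lookup (coefficients (suc k) (χ T))))
  krylov-companionBasis {k} T w = companionBasis row
    where
    row : ∀ i → krylov T w i · T ≋ transpose (companion (neg (lookup (coefficients (suc k) (χ T))))) i · krylov T w
    row i j with view i
    ... | ‵inject₁ l = begin
      (power T (toℕ (inject₁ l)) w · T) j
        ≡⟨ power-suc T (toℕ (inject₁ l)) w j ⟨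
      power T (suc (toℕ (inject₁ l))) w j
        ≡⟨ cong (λ n → power T (suc n) w j) (Fin.toℕ-inject₁ l) ⟩
      krylov T w (suc l) j
        ≡⟨ δ-sum (λ i → krylov T w i j) (suc l) ⟨
      (δ (suc l) · krylov T w) j
        ≡⟨ ·-congˡ (krylov T w) (companion-shift c l) j ⟨
      (transpose (companion c) (inject₁ l) · krylov T w) j ∎
      where
      open ≡-Reasoning
      c = neg (lookup (coefficients (suc k) (χ T)))
    ... | ‵fromℕ = begin
      (power T (toℕ (fromℕ k)) w · T) j
        ≡⟨ power-suc T (toℕ (fromℕ k)) w j ⟨
      power T (suc (toℕ (fromℕ k))) w j
        ≡⟨ cong (λ n → power T (suc n) w j) (Fin.toℕ-fromℕ k) ⟩
      power T (suc k) w j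
        ≡⟨ +-inverseʳ-unique _ _ annihilated ⟩
      - (lookup cs · krylov T w) j
        ≡⟨ neg-· (lookup cs) (krylov T w) j ⟨
      (neg (lookup cs) · krylov T w) j
        ≡⟨ ·-congˡ (krylov T w) (companion-last (neg (lookup cs))) j ⟨
      (transpose (companion (neg (lookup cs))) (fromℕ k) · krylov T w) j ∎
      where
      open ≡-Reasoning
      cs = coefficients (suc k) (χ T)

      annihilated : (lookup cs · krylov T w) j + power T (suc k) w j ≡ 0#
      annihilated = trans (sym (eval-monicPoly T cs w j))
        (trans (eval-cong T (≐-sym (monic⇒≐ (suc k) (χ T) (χ-monic T))) w j) (cayley-hamilton T w j))

  companion-cong : ∀ {k} {c d : V k} → c ≋ d → ∀ i j → companion c i j ≡ companion d i j
  companion-cong {k} c≋d i j with does (suc (toℕ j) ℕ.≟ k)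
  ... | true  = c≋d i
  ... | false = refl

  companionBasis-cong : ∀ {k} {P P′ T : SqMatrix k} {c c′} → (∀ i → P i ≋ P′ i) → c ≋ c′ →
    CompanionBasis P T c → CompanionBasis P′ T c′
  companionBasis-cong {P = P} {P′} {T} {c} {c′} P≋ c≋ basis = companionBasis λ i j → begin
    (P′ i · T) j                            ≡⟨ ·-congˡ T (P≋ i) j ⟨
    (P i · T) j                             ≡⟨ row-image basis i j ⟩
    (transpose (companion c) i · P) j       ≡⟨ ·-congˡ P (λ l → companion-cong c≋ l i) j ⟩
    (transpose (companion c′) i · P) j      ≡⟨ ·-congʳ (transpose (companion c′) i) P≋ j ⟩
    (transpose (companion c′) i · P′) j     ∎
    where open ≡-Reasoning

  -- The relation fixes P T, and `N` on the left cancels `P`.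
  companionBasis-unique : ∀ {k} {P T T′ : SqMatrix k} {c} → Invertible P →
    CompanionBasis P T c → CompanionBasis P T′ c → ∀ i → T i ≋ T′ i
  companionBasis-unique {P = P} {T} {T′} (N , _ , NP) basis basis′ i j = begin
    T i j                          ≡⟨ expand T ⟩
    (N i · (λ l → P l · T)) j      ≡⟨ ·-congʳ (N i) (λ l j → trans (row-image basis l j) (sym (row-image basis′ l j))) j ⟩
    (N i · (λ l → P l · T′)) j     ≡⟨ expand T′ ⟨
    T′ i j                         ∎
    where
    open ≡-Reasoning
    expand : ∀ S → S i j ≡ (N i · (λ l → P l · S)) j
    expand S = trans (sym (δ-sum (λ l → S l j) i))
      (trans (·-congˡ S (λ l → sym (NP i l)) j) (·-assoc (N i) P S j))

  -- The witness is the conjugate N C P, with C the transposed companion matrix and `N` the inverse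
  -- of `P`.
  companionBasis-exists : ∀ {k} {P : SqMatrix k} (c : V k) → Invertible P → ∃ λ T → CompanionBasis P T c
  companionBasis-exists {P = P} c (N , PN , _) =
    (λ i → N i · (λ l → transpose (companion c) l · P)) , companionBasis λ i j → begin
      (P i · (λ l → N l · (λ l → transpose (companion c) l · P))) j
        ≡⟨ ·-assoc (P i) N (λ l → transpose (companion c) l · P) j ⟨
      (P i · N · (λ l → transpose (companion c) l · P)) j
        ≡⟨ ·-congˡ (λ l → transpose (companion c) l · P) (PN i) j ⟩
      (δ i · (λ l → transpose (companion c) l · P)) j
        ≡⟨ δ-sum (λ l → (transpose (companion c) l · P) j) i ⟩
      (transpose (companion c) i · P) j ∎
    where open ≡-Reasoning

  -- As f(T) kills all rows it kills all columns too: w · (f(T) u) = (w · f(T)) u.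
  eval-adjoint : ∀ {k} (T : SqMatrix k) f w u → dot (eval T f w) u ≡ dot w (eval (transpose T) f u)
  eval-adjoint T []      w u = trans (sum-0 λ i → zeroˡ (u i)) (sym (sum-0 λ i → zeroʳ (w i)))
  eval-adjoint T (a ∷ f) w u = begin
    dot (λ i → a * w i + eval T f (w · T) i) u
      ≡⟨ dot-+ (λ i → a * w i) (eval T f (w · T)) ⟩
    dot (λ i → a * w i) u + dot (eval T f (w · T)) u
      ≡⟨ cong₂ _+_ (sum-cong-≗ λ i → swap (w i) (u i)) step ⟩
    dot w (λ i → a * u i) + dot w (eval (transpose T) f (u · transpose T))
      ≡⟨ ∑-distrib-+ (λ i → w i * (a * u i)) (λ i → w i * eval (transpose T) f (u · transpose T) i) ⟨
    sum (λ i → w i * (a * u i) + w i * eval (transpose T) f (u · transpose T) i)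
      ≡⟨ sum-cong-≗ (λ i → distribˡ (w i) (a * u i) (eval (transpose T) f (u · transpose T) i)) ⟨
    dot w (λ i → a * u i + eval (transpose T) f (u · transpose T) i) ∎
    where
    open ≡-Reasoning
    swap : ∀ x y → a * x * y ≡ x * (a * y)
    swap x y = trans (cong (_* y) (*-comm a x)) (*-assoc x a y)

    dot-+ : ∀ v v′ → dot (λ i → v i + v′ i) u ≡ dot v u + dot v′ u
    dot-+ v v′ = trans (sum-cong-≗ λ i → distribʳ (u i) (v i) (v′ i))
      (∑-distrib-+ (λ i → v i * u i) (λ i → v′ i * u i))

    dot-· : ∀ v v′ → dot (v · T) v′ ≡ dot v (v′ · transpose T)
    dot-· v v′ = begin
      sum (λ j → sum (λ i → v i * T i j) * v′ j)
        ≡⟨ sum-cong-≗ (λ j → *-distribʳ-sum (v′ j) (λ i → v i * T i j)) ⟩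
      sum (λ j → sum λ i → v i * T i j * v′ j)
        ≡⟨ ∑-comm (λ j i → v i * T i j * v′ j) ⟩
      sum (λ i → sum λ j → v i * T i j * v′ j)
        ≡⟨ sum-cong-≗ (λ i → trans
             (sum-cong-≗ λ j → trans (*-assoc (v i) (T i j) (v′ j)) (cong (v i *_) (*-comm (T i j) (v′ j))))
             (sym (*-distribˡ-sum (v i) (λ j → v′ j * T i j)))) ⟩
      sum (λ i → v i * sum (λ j → v′ j * T i j)) ∎

    step : dot (eval T f (w · T)) u ≡ dot w (eval (transpose T) f (u · transpose T))
    step = begin
      dot (eval T f (w · T)) u                          ≡⟨ eval-adjoint T f (w · T) u ⟩
      dot (w · T) (eval (transpose T) f u)              ≡⟨ dot-· w (eval (transpose T) f u) ⟩
      dot w (eval (transpose T) f u · transpose T)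
        ≡⟨ sum-cong-≗ (λ i → cong (w i *_) (eval-· (transpose T) f u i)) ⟩
      dot w (eval (transpose T) f (u · transpose T))    ∎

  -- Pairing with each unit vector moves the polynomial across by `eval-adjoint`, to the side where
  -- Cayley-Hamilton applies.
  transpose-annihilates : ∀ {k} (T : SqMatrix k) u → eval (transpose T) (χ T) u ≋ 0ᵛ
  transpose-annihilates T u i = begin
    eval (transpose T) (χ T) u i                  ≡⟨ δ-sum (eval (transpose T) (χ T) u) i ⟨
    dot (δ i) (eval (transpose T) (χ T) u)        ≡⟨ eval-adjoint T (χ T) (δ i) u ⟨
    dot (eval T (χ T) (δ i)) u
      ≡⟨ sum-0 (λ j → trans (cong (_* u j) (cayley-hamilton T (δ i) j)) (zeroˡ (u j))) ⟩
    0#                                            ∎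
    where open ≡-Reasoning

  -- The transpose of a companion matrix sends each unit vector to the next, so the identity matrix
  -- is a companion basis for it and e_0 is cyclic. Since `χ C` kills e_0 under the transpose,
  -- uniqueness of the annihilator identifies it.
  χ-companion : ∀ {k} (cs : Vec Carrier (suc k)) → χ (companion (neg (lookup cs))) ≐ monicPoly cs
  χ-companion cs = companionBasis-χ {P = δ} {transpose C} cs
    (λ {u} {v} eq i → trans (sym (sum-δ u i)) (trans (eq i) (sum-δ v i)))
    (companionBasis λ i j → trans (δ-sum (λ l → C j l) i) (sym (sum-δ (λ l → C l i) j)))
    (χ C) (χ-monic C) (transpose-annihilates C (δ zero))
    where C = companion (neg (lookup cs))

-- Counting matrices by characteristic polynomial

module Counting {q : ℕ} (F : FiniteField q) where
  open FiniteField F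
  open FF F
  open Polynomials F
  open CharacteristicPolynomial F
  open CyclicVectors F
  open import Algebra.Properties.Semiring.Sum (CommutativeRing.semiring fieldRing)
  open Determinant fieldRing using (δ; sum-0)

  -- Deciding irreducibility and primitivity

  _≈P?_ : ∀ f g → Dec (f ≈P g)
  f ≈P? g = List.≡-dec _≟_ (normalize f) (normalize g)

  deg-cong : ∀ {f g} → f ≐ g → deg f ≡ deg g
  deg-cong f≐g = cong (λ h → length h ℕ.∸ 1) (≐⇒≈P f≐g)

  factors-degreeBelow : ∀ {k} g h f → Monic k f → g *P h ≐ f →
    DegreeBelow (suc k) g × DegreeBelow (suc k) h
  factors-degreeBelow {k} g h f mf gh≐f =
    right h g (≐-trans (*P-comm h g) gh≐f) , right g h gh≐f
    where
    right : ∀ g h → g *P h ≐ f → DegreeBelow (suc k) h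
    right g h gh≐f with leading g
    ... | inj₁ g≐[] = contradiction
      (trans (sym (coeff-≡ gh≐f k)) (coeff-≡ (*P-zeroˡ g≐[] h) k)) (monic-nonzero {f = f} mf)
    ... | inj₂ (a , _ , top , bg) = factor-degreeBelow g f h top bg gh≐f (proj₂ mf)

  -- Factors of a monic polynomial of degree k have degree at most k, so up to `_≐_` they are among
  -- the finitely many lists of k + 1 coefficients.
  irreducible? : ∀ {k} (cs : Vec Carrier k) → Dec (Irreducible (monicPoly cs))
  irreducible? {k} cs = (1 ℕ.≤? deg f) ×-dec Dec.map′ extend (λ irr g h → irr (toList g) (toList h))
    (∀? vectors λ g → ∀? vectors λ h → (toList g *P toList h) ≈P? f →-dec
      ((deg (toList g) ℕ.≟ 0) ⊎-dec (deg (toList h) ℕ.≟ 0)))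
    where
    f = monicPoly cs
    vectors = finite-vec finite-field (suc k)

    extend : (∀ (g h : Vec Carrier (suc k)) → (toList g *P toList h) ≈P f →
      deg (toList g) ≡ 0 ⊎ deg (toList h) ≡ 0) →
      ∀ g h → (g *P h) ≈P f → deg g ≡ 0 ⊎ deg h ≡ 0
    extend small g h gh≈f =
      Sum.map (trans (deg-cong g≐)) (trans (deg-cong h≐))
        (small (coefficients (suc k) g) (coefficients (suc k) h)
          (≐⇒≈P (≐-trans (≐-sym (*P-cong g≐ h≐)) (≈P⇒≐ {g *P h} {f} gh≈f))))
      where
      bounds = factors-degreeBelow g h f (monicPoly-monic cs) (≈P⇒≐ {g *P h} {f} gh≈f)
      g≐ = degreeBelow⇒≐ (suc k) g (proj₁ bounds)
      h≐ = degreeBelow⇒≐ (suc k) h (proj₂ bounds)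

  degreeBelow-length : ∀ f → DegreeBelow (length f) f
  degreeBelow-length []      i       _        = refl
  degreeBelow-length (a ∷ f) (suc i) (s≤s le) = degreeBelow-length f i le

  -- A quotient never needs more coefficients than `g` has, which leaves finitely many candidates.
  monic-∣P? : ∀ {k} f → Monic k f → ∀ g → Dec (f ∣P g)
  monic-∣P? {k} f mf g = Dec.map′ (λ (h , fh≈g) → toList h , fh≈g) restrict
    (∃? (finite-vec finite-field (length g)) λ h → (f *P toList h) ≈P? g)
    where
    restrict : f ∣P g → ∃ λ (h : Vec Carrier (length g)) → (f *P toList h) ≈P g
    restrict (h , fh≈g) = coefficients (length g) h ,
      ≐⇒≈P (≐-trans (*P-congˡ f (≐-sym (degreeBelow⇒≐ (length g) h
        (factor-degreeBelow f g h (monic-nonzero {f = f} mf) (proj₂ mf) (≈P⇒≐ {f *P h} {g} fh≈g) (degreeBelow-length g)))))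
        (≈P⇒≐ {f *P h} {g} fh≈g))

  primitive? : ∀ {k} (cs : Vec Carrier k) → Dec (Primitive (monicPoly cs))
  primitive? cs = irreducible? cs ×-dec divides? (XpowMinus1 (q ℕ.^ deg f ℕ.∸ 1)) ×-dec
    Dec.map′ (λ all e 1≤e e<N → all e<N 1≤e) (λ all {e} e<N 1≤e → all e 1≤e e<N)
      (ℕ.allUpTo? (λ e → (1 ℕ.≤? e) →-dec ¬? (divides? (XpowMinus1 e))) (q ℕ.^ deg f ℕ.∸ 1))
    where
    f = monicPoly cs
    divides? = monic-∣P? f (monicPoly-monic cs)

  irreducible-cong : ∀ {f g} → f ≐ g → Irreducible f → Irreducible g
  irreducible-cong f≐g (1≤deg , irr) = subst (1 ℕ.≤_) (deg-cong f≐g) 1≤deg ,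
    λ g₁ g₂ g₁g₂≈g → irr g₁ g₂ (trans g₁g₂≈g (sym (≐⇒≈P f≐g)))

  ∣P-cong : ∀ {f g} h → f ≐ g → f ∣P h → g ∣P h
  ∣P-cong h f≐g (t , ft≈h) = t , trans (≐⇒≈P (*P-congʳ t (≐-sym f≐g))) ft≈h

  primitive-cong : ∀ {f g} → f ≐ g → Primitive f → Primitive g
  primitive-cong {f} {g} f≐g (irr , divides , minimal) = irreducible-cong f≐g irr ,
    subst (λ d → g ∣P XpowMinus1 (q ℕ.^ d ℕ.∸ 1)) (deg-cong f≐g) (∣P-cong (XpowMinus1 (q ℕ.^ deg f ℕ.∸ 1)) f≐g divides) ,
    λ e 1≤e e<N g∣ → minimal e 1≤e (subst (λ d → e ℕ.< q ℕ.^ d ℕ.∸ 1) (sym (deg-cong f≐g)) e<N)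
      (∣P-cong (XpowMinus1 e) (≐-sym f≐g) g∣)

  -- Passing between matrices as vectors and as functions

  toMat : ∀ {k} → SqMatrix k → Mat k
  toMat P = tabulate (tabulate ∘ P)

  entry-toMat : ∀ {k} (P : SqMatrix k) i j → entry (toMat P) i j ≡ P i j
  entry-toMat P i j = trans (cong (λ row → lookup row j) (Vec.lookup∘tabulate (tabulate ∘ P) i))
    (Vec.lookup∘tabulate (P i) j)

  toMat-entry : ∀ {k} (M : Mat k) → toMat (entry M) ≡ M
  toMat-entry M = trans (Vec.tabulate-cong λ i → Vec.tabulate∘lookup (lookup M i)) (Vec.tabulate∘lookup M)

  toMat-cong : ∀ {k} {P Q : SqMatrix k} → (∀ i → P i ≋ Q i) → toMat P ≡ toMat Q
  toMat-cong P≋Q = Vec.tabulate-cong λ i → Vec.tabulate-cong (P≋Q i)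

  entry-≡⇒≡ : ∀ {k} {M N : Mat k} → (∀ i → entry M i ≋ entry N i) → M ≡ N
  entry-≡⇒≡ {M = M} {N} M≋N = trans (sym (toMat-entry M)) (trans (toMat-cong M≋N) (toMat-entry N))

  sumF-tabulate : ∀ {k} (f : Fin k → Carrier) → sumF (tabulate f) ≡ sum f
  sumF-tabulate {zero}  f = refl
  sumF-tabulate {suc k} f = cong (f zero +_) (sumF-tabulate (f ∘ suc))

  entry-*M : ∀ {k} (M N : Mat k) i → entry (M *M N) i ≋ entry M i · entry N
  entry-*M M N i j = trans (entry-toMat (λ i l → sumF (tabulate λ j → entry M i j * entry N j l)) i j)
    (sumF-tabulate λ l → entry M i l * entry N l j)

  GL⇒invertible : ∀ {k} (M : Mat k) → GL k M → Invertible (entry M)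
  GL⇒invertible M (N , MN , NM) = entry N , inverse-of M N MN , inverse-of N M NM
    where
    inverse-of : ∀ M N → M *M N ≡ idM → ∀ i → entry M i · entry N ≋ δ i
    inverse-of M N MN i j = trans (sym (entry-*M M N i j)) (trans (cong (λ A → entry A i j) MN) (entry-toMat δ i j))

  invertible⇒GL : ∀ {k} (M : Mat k) → Invertible (entry M) → GL k M
  invertible⇒GL {k} M (N , MN , NM) = toMat N ,
    entry-≡⇒≡ (λ i j → trans (entry-*M M (toMat N) i j) (trans
      (·-congʳ (entry M i) (entry-toMat N) j) (trans (MN i j) (sym (entry-toMat δ i j))))) ,
    entry-≡⇒≡ (λ i j → trans (entry-*M (toMat N) M i j) (trans
      (·-congˡ (entry M) (entry-toMat N i) j) (trans (NM i j) (sym (entry-toMat δ i j)))))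

  finite-mat : ∀ k → Finite (Mat k) ((q ℕ.^ k) ℕ.^ k)
  finite-mat k = finite-vec (finite-vec finite-field k) k

  _≟M_ : ∀ {k} (M N : Mat k) → Dec (M ≡ N)
  _≟M_ = Vec.≡-dec (Vec.≡-dec _≟_)

  GL? : ∀ {k} (M : Mat k) → Dec (GL k M)
  GL? {k} M = ∃? (finite-mat k) λ N → ((M *M N) ≟M idM) ×-dec ((N *M M) ≟M idM)

  charPoly-toMat : ∀ {k} (T : SqMatrix k) → charPoly (toMat T) ≐ χ T
  charPoly-toMat T = ≐-trans (charPoly≐χ (toMat T)) (Det.det-cong λ i j →
    ≡⇒≐ (cong (λ x → if does (i Fin.≟ j) then (- x) ∷ 1# ∷ [] else (- x) ∷ []) (entry-toMat T i j)))

  charCoefficients : ∀ {k} → Mat k → Vec Carrier k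
  charCoefficients {k} T = coefficients k (χ (entry T))

  charPoly≐monicPoly : ∀ {k} (T : Mat k) → charPoly T ≐ monicPoly (charCoefficients T)
  charPoly≐monicPoly {k} T = ≐-trans (charPoly≐χ T) (monic⇒≐ k (χ (entry T)) (χ-monic (entry T)))

  -- TSR matrices with n = 1 or m = 1

  -- The body of `tsr` with the quotients and remainders as variables, so that they can be matched
  -- on when m or n is 1.
  tsrBlock : ∀ {m n} → Vec Carrier n → Mat m → Fin n → Fin m → Fin n → Fin m → Carrier
  tsrBlock {m} {n} c B a r b s =
    if does (suc (toℕ b) ℕ.≟ n)
      then lookup c a * entry B r s
      else (if does (toℕ a ℕ.≟ suc (toℕ b))
              then (if does (r Fin.≟ s) then 1# else 0#)
              else 0#)

  entry-tsr : ∀ m n c (B : Mat m) i j → entry (tsr m n c B) i j ≡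
    tsrBlock c B (proj₁ (remQuot {n} m i)) (proj₂ (remQuot {n} m i))
                 (proj₁ (remQuot {n} m j)) (proj₂ (remQuot {n} m j))
  entry-tsr m n c B = entry-toMat λ i j →
    tsrBlock c B (proj₁ (remQuot {n} m i)) (proj₂ (remQuot {n} m i))
                 (proj₁ (remQuot {n} m j)) (proj₂ (remQuot {n} m j))

  zero-unique : (i : Fin 1) → zero ≡ i
  zero-unique zero = refl

  -- The only block column is the last one, and its block is c_0 B; take c_0 = 1 and for `B` the
  -- matrix `T`, reindexed from size 1 * m to m.
  isTSR-m×1 : ∀ m (T : Mat (1 ℕ.* m)) → IsTSR m 1 T
  isTSR-m×1 m T = c , B , entry-≡⇒≡ λ i j → sym (trans (entry-tsr m 1 c B i j) (trans
    (single-block (proj₁ (remQuot {1} m i)) (proj₂ (remQuot {1} m i))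
                  (proj₁ (remQuot {1} m j)) (proj₂ (remQuot {1} m j)))
    (trans (entry-toMat (λ r s → entry T (combine {1} zero r) (combine {1} zero s)) _ _)
    (cong₂ (entry T) (recombine i) (recombine j)))))
    where
    c : Vec Carrier 1
    c = 1# ∷ []

    B : Mat m
    B = toMat λ r s → entry T (combine {1} zero r) (combine {1} zero s)

    single-block : ∀ a r b s → tsrBlock c B a r b s ≡ entry B r s
    single-block zero r zero s = *-identityˡ _

    recombine : ∀ (i : Fin (1 ℕ.* m)) → combine {1} zero (proj₂ (remQuot {1} m i)) ≡ i
    recombine i = trans (cong (λ a → combine {1} a (proj₂ (remQuot {1} m i))) (zero-unique (proj₁ (remQuot {1} m i))))
      (Fin.combine-remQuot {1} m i)

  module _ {n : ℕ} where
    private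
      block : Fin (n ℕ.* 1) → Fin n
      block = proj₁ ∘ remQuot {n} 1

    recombine : ∀ i → combine (block i) zero ≡ i
    recombine i = trans (cong (combine (block i)) (zero-unique (proj₂ (remQuot {n} 1 i)))) (Fin.combine-remQuot {n} 1 i)

    toℕ-block : ∀ i → toℕ (block i) ≡ toℕ i
    toℕ-block i = begin
      toℕ (block i)                    ≡⟨ trans (ℕ.+-identityʳ _) (ℕ.*-identityˡ (toℕ (block i))) ⟨
      1 ℕ.* toℕ (block i) ℕ.+ 0        ≡⟨ Fin.toℕ-combine (block i) (zero {0}) ⟨
      toℕ (combine (block i) (zero {0})) ≡⟨ cong toℕ (recombine i) ⟩
      toℕ i                            ∎
      where open ≡-Reasoning

    -- With 1 × 1 blocks the block index of `i` has the same value as `i`, and `B` is a scalar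
    -- absorbed into the last column. The size n * 1 equals `n` only propositionally, hence the
    -- rewriting of the index tests.
    tsr-1×n : ∀ c B → tsr 1 n c B ≡ toMat (companion λ i → lookup c (block i) * entry B zero zero)
    tsr-1×n c B = entry-≡⇒≡ λ i j → trans (entry-tsr 1 n c B i j)
      (trans (entries i j) (sym (entry-toMat (companion λ i → lookup c (block i) * entry B zero zero) i j)))
      where
      inner : ∀ (r s : Fin 1) a b → tsrBlock c B a r b s ≡ tsrBlock c B a zero b zero
      inner zero zero a b = refl

      entries : ∀ i j → tsrBlock c B (block i) (proj₂ (remQuot {n} 1 i)) (block j) (proj₂ (remQuot {n} 1 j))
        ≡ companion (λ i → lookup c (block i) * entry B zero zero) i j
      entries i j = trans (inner _ _ (block i) (block j)) (cong₂
        (λ last shift → if last then lookup c (block i) * entry B zero zero else if shift then 1# else 0#)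
        (cong₂ (λ x y → does (suc x ℕ.≟ y)) (toℕ-block j) (sym (ℕ.*-identityʳ n)))
        (cong₂ (λ x y → does (x ℕ.≟ suc y)) (toℕ-block i) (toℕ-block j)))

    -- With `B` the 1 × 1 matrix with entry 1, the last column can be prescribed freely.
    companion-isTSR : ∀ (c : V (n ℕ.* 1)) → IsTSR 1 n (toMat (companion c))
    companion-isTSR c = blocks , (1# ∷ []) ∷ [] ,
      trans (toMat-cong (companion-cong coefficient)) (sym (tsr-1×n blocks ((1# ∷ []) ∷ [])))
      where
      blocks = tabulate λ a → c (combine a zero)

      coefficient : ∀ i → c i ≡ lookup blocks (block i) * 1#
      coefficient i = sym (trans (*-identityʳ _)
        (trans (Vec.lookup∘tabulate (λ a → c (combine a zero)) (block i)) (cong c (recombine i))))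

  companion-injective : ∀ {k} {c d : V (suc k)} → toMat (companion c) ≡ toMat (companion d) → c ≋ d
  companion-injective {k} {c} {d} eq i = trans (sym (companion-last c i)) (trans
    (trans (sym (entry-toMat (companion c) i (fromℕ k)))
      (trans (cong (λ M → entry M i (fromℕ k)) eq) (entry-toMat (companion d) i (fromℕ k))))
    (companion-last d i))

  -- Instantiated with Irreducible and with Primitive.
  module _ (Good : Poly → Set)
           (good-cong : ∀ {f g} → f ≐ g → Good f → Good g)
           (good⇒irreducible : ∀ {f} → Good f → Irreducible f)
           (good? : ∀ {k} (cs : Vec Carrier k) → Dec (Good (monicPoly cs))) where

    module _ {k : ℕ} where
      private
        K = suc k

      CyclicPair GLPair : Mat K × Vec Carrier K → Set
      CyclicPair (T , w) = Good (charPoly T) × w ≢ tabulate 0ᵛ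
      GLPair (M , cs) = GL K M × Good (monicPoly cs)

      krylovPair : Mat K × Vec Carrier K → Mat K × Vec Carrier K
      krylovPair (T , w) = toMat (krylov (entry T) (lookup w)) , charCoefficients T

      lookup≢0 : ∀ {w : Vec Carrier K} → w ≢ tabulate 0ᵛ → ¬ (lookup w ≋ 0ᵛ)
      lookup≢0 {w} w≢0 w≋0 = w≢0 (trans (sym (Vec.tabulate∘lookup w)) (Vec.tabulate-cong w≋0))

      krylov-invertible : ∀ x → CyclicPair x → Invertible (krylov (entry (proj₁ x)) (lookup (proj₂ x)))
      krylov-invertible (T , w) (good , w≢0) = injective⇒invertible {P = krylov (entry T) (lookup w)}
        (krylov-injective (entry T) (lookup w) (lookup≢0 w≢0)
          (irreducible-cong (charPoly≐χ T) (good⇒irreducible good)))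

      invertible-cong : ∀ {P P′ : SqMatrix K} → (∀ i → P i ≋ P′ i) → Invertible P → Invertible P′
      invertible-cong P≋ (N , PN , NP) = N ,
        (λ i j → trans (·-congˡ N (sym ∘ P≋ i) j) (PN i j)) ,
        (λ i j → trans (·-congʳ (N i) (λ l → sym ∘ P≋ l) j) (NP i j))

      krylovPair-GL : ∀ x → CyclicPair x → GLPair (krylovPair x)
      krylovPair-GL (T , w) cyclic@(good , _) =
        invertible⇒GL (toMat P) (invertible-cong {P} (λ i j → sym (entry-toMat P i j))
          (krylov-invertible (T , w) cyclic)) ,
        good-cong (charPoly≐monicPoly T) good
        where P = krylov (entry T) (lookup w)

      -- Row zero of the common Krylov matrix is the vector. Both matrices then satisfy the
      -- companion relation for the same invertible rows and the same coefficients, which determines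
      -- them.
      krylovPair-injective : ∀ x y → CyclicPair x → CyclicPair y → krylovPair x ≡ krylovPair y → x ≡ y
      krylovPair-injective (T , w) (T′ , w′) cyclic cyclic′ eq = cong₂ _,_ T≡T′ w≡w′
        where
        krylov≋ : ∀ i → krylov (entry T) (lookup w) i ≋ krylov (entry T′) (lookup w′) i
        krylov≋ i j = trans (sym (entry-toMat (krylov (entry T) (lookup w)) i j))
          (trans (cong (λ x → entry (proj₁ x) i j) eq) (entry-toMat (krylov (entry T′) (lookup w′)) i j))

        w≡w′ : w ≡ w′
        w≡w′ = trans (sym (Vec.tabulate∘lookup w))
          (trans (Vec.tabulate-cong (krylov≋ zero)) (Vec.tabulate∘lookup w′))

        T≡T′ : T ≡ T′
        T≡T′ = entry-≡⇒≡ (companionBasis-unique (krylov-invertible (T , w) cyclic)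
          (krylov-companionBasis (entry T) (lookup w))
          (companionBasis-cong (λ i j → sym (krylov≋ i j))
            (λ i → cong (λ x → - lookup (proj₂ x) i) (sym eq))
            (krylov-companionBasis (entry T′) (lookup w′))))

      -- Conjugating the transposed companion matrix of `cs` by `M` gives a matrix for which the
      -- rows of `M` are the Krylov sequence of the first row; the annihilator of that row is both χ
      -- and `monicPoly cs`.
      krylovPair-surjective : ∀ y → GLPair y → ∃ λ x → CyclicPair x × krylovPair x ≡ y
      krylovPair-surjective (M , cs) (M∈GL , good) = (toMat T , w) , (good′ , w≢0) ,
        cong₂ _,_ krylov≡M coefficients≡cs
        where
        M-invertible = GL⇒invertible M M∈GL
        constructed = companionBasis-exists {P = entry M} (neg (lookup cs)) M-invertible
        T = proj₁ constructed
        basis = proj₂ constructed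
        w = lookup M zero

        χ≐ : χ T ≐ monicPoly cs
        χ≐ = companionBasis-χ cs (invertible⇒injective {P = entry M} M-invertible) basis (χ T) (χ-monic T)
          (cayley-hamilton T (entry M zero))

        charPoly≐ : charPoly (toMat T) ≐ monicPoly cs
        charPoly≐ = ≐-trans (charPoly-toMat T) χ≐

        good′ : Good (charPoly (toMat T))
        good′ = good-cong (≐-sym charPoly≐) good

        -- A zero first row would give the zero vector and e_0 the same image under `M`.
        w≢0 : w ≢ tabulate 0ᵛ
        w≢0 w≡0 = 0≢1 (invertible⇒injective {P = entry M} M-invertible {0ᵛ} {δ zero} equal zero)
          where
          open ≡-Reasoning
          equal : 0ᵛ · entry M ≋ δ zero · entry M
          equal j = begin
            (0ᵛ · entry M) j         ≡⟨ sum-0 (λ i → zeroˡ (entry M i j)) ⟩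
            0#                       ≡⟨ Vec.lookup∘tabulate 0ᵛ j ⟨
            lookup (tabulate 0ᵛ) j   ≡⟨ cong (λ v → lookup v j) w≡0 ⟨
            entry M zero j           ≡⟨ δ-sum (λ l → entry M l j) zero ⟨
            (δ zero · entry M) j     ∎

        krylov≡M : toMat (krylov (entry (toMat T)) (lookup w)) ≡ M
        krylov≡M = trans (toMat-cong λ i j → trans
            (power-cong (entry-toMat T) (toℕ i) (lookup w) j) (companionBasis-krylov basis i j))
          (toMat-entry M)

        coefficients≡cs : charCoefficients (toMat T) ≡ cs
        coefficients≡cs = trans (Vec.tabulate-cong λ i → trans
            (coeff-≡ (≐-trans (≐-sym (charPoly≐χ (toMat T))) charPoly≐) (toℕ i)) (coeff-monicPoly cs i))
          (Vec.tabulate∘lookup cs)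

      -- `krylovPair` carries an enumeration of cyclic pairs to one of the pairs (P, f), so one set
      -- has both a (q^K - 1) and g i elements.
      count-by-charPoly : ∃ λ a → ∃ λ g → ∃ λ i →
        HasCard (λ (T : Mat K) → Good (charPoly T)) a × HasCard (GL K) g ×
        HasCard (λ (cs : Vec Carrier K) → Good (monicPoly cs)) i × a ℕ.* (q ℕ.^ K ℕ.∸ 1) ≡ g ℕ.* i
      count-by-charPoly = _ , _ , _ , proj₂ matrices , proj₂ invertibles , proj₂ polynomials ,
        hasCard-unique
          (hasCard-map krylovPair (λ {x} → krylovPair-GL x) (λ {x} {y} → krylovPair-injective x y)
            (λ {y} → krylovPair-surjective y)
            (hasCard-× (proj₂ matrices)
              (hasCard-≢ (finite-vec finite-field K) (Vec.≡-dec _≟_) (tabulate 0ᵛ))))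
          (hasCard-× (proj₂ invertibles) (proj₂ polynomials))
        where
        matrices = decidable-hasCard (finite-mat K) λ T → Dec.map′
          (good-cong (≐-sym (charPoly≐monicPoly T))) (good-cong (charPoly≐monicPoly T))
          (good? (charCoefficients T))
        invertibles = decidable-hasCard (finite-mat K) GL?
        polynomials = decidable-hasCard (finite-vec finite-field K) good?

    TSR-m×1 : ∀ m → 1 ℕ.≤ m → ∃ λ a → ∃ λ g → ∃ λ i →
      HasCard (λ T → IsTSR m 1 T × Good (charPoly T)) a × HasCard (GL m) g ×
      HasCard (λ (cs : Vec Carrier m) → Good (monicPoly cs)) i × a ℕ.* (q ℕ.^ m ℕ.∸ 1) ≡ g ℕ.* i
    TSR-m×1 (suc m) _ = rebase (ℕ.*-identityˡ (suc m)) count-by-charPoly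
      where
      -- TSR matrices here have size 1 * (m + 1), whereas `GL` and the polynomials are wanted at m +
      -- 1. Keeping the latter size a variable lets `refl` identify the two.
      rebase : ∀ {k} → 1 ℕ.* suc m ≡ k →
        (∃ λ a → ∃ λ g → ∃ λ i →
          HasCard (λ (T : Mat (1 ℕ.* suc m)) → Good (charPoly T)) a × HasCard (GL (1 ℕ.* suc m)) g ×
          HasCard (λ (cs : Vec Carrier (1 ℕ.* suc m)) → Good (monicPoly cs)) i ×
          a ℕ.* (q ℕ.^ (1 ℕ.* suc m) ℕ.∸ 1) ≡ g ℕ.* i) →
        ∃ λ a → ∃ λ g → ∃ λ i →
          HasCard (λ T → IsTSR (suc m) 1 T × Good (charPoly T)) a × HasCard (GL k) g ×
          HasCard (λ (cs : Vec Carrier k) → Good (monicPoly cs)) i × a ℕ.* (q ℕ.^ k ℕ.∸ 1) ≡ g ℕ.* i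
      rebase refl (a , g , i , matrices , rest) =
        a , g , i , hasCard-cong (λ T → mk⇔ (isTSR-m×1 (suc m) T ,_) proj₂) matrices , rest

    -- The bijection sends f to the companion matrix whose last column holds the negated lower
    -- coefficients of f. By `χ-companion` its characteristic polynomial is f, so `Good` passes in
    -- both directions.
    TSR-1×n : ∀ n → 1 ℕ.≤ n → ∃ λ a →
      HasCard (λ T → IsTSR 1 n T × Good (charPoly T)) a ×
      HasCard (λ (cs : Vec Carrier n) → Good (monicPoly cs)) a
    TSR-1×n (suc n) _
      with a , pol ← decidable-hasCard (finite-vec finite-field (suc n ℕ.* 1)) good? =
      a , hasCard-map toTSR (λ {cs} → toTSR-good cs) (λ {cs} {ds} _ _ → toTSR-injective cs ds)
        (λ {T} → toTSR-surjective T) pol ,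
      -- The polynomials are enumerated at length (n + 1) * 1, the size of the matrices, and moved
      -- to length n + 1 only here.
      subst (λ k → HasCard (λ (cs : Vec Carrier k) → Good (monicPoly cs)) a) (ℕ.*-identityʳ (suc n)) pol
      where
      toTSR : Vec Carrier (suc n ℕ.* 1) → Mat (suc n ℕ.* 1)
      toTSR cs = toMat (companion (neg (lookup cs)))

      charPoly-toTSR : ∀ cs → charPoly (toTSR cs) ≐ monicPoly cs
      charPoly-toTSR cs = ≐-trans (charPoly-toMat (companion (neg (lookup cs)))) (χ-companion cs)

      toTSR-good : ∀ cs → Good (monicPoly cs) → IsTSR 1 (suc n) (toTSR cs) × Good (charPoly (toTSR cs))
      toTSR-good cs good = companion-isTSR {suc n} (neg (lookup cs)) , good-cong (≐-sym (charPoly-toTSR cs)) good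

      toTSR-injective : ∀ cs ds → toTSR cs ≡ toTSR ds → cs ≡ ds
      toTSR-injective cs ds eq = trans (sym (Vec.tabulate∘lookup cs)) (trans
        (Vec.tabulate-cong λ i → trans (sym (-‿involutive _))
          (trans (cong -_ (companion-injective {c = neg (lookup cs)} {neg (lookup ds)} eq i)) (-‿involutive _)))
        (Vec.tabulate∘lookup ds))

      toTSR-surjective : ∀ T → IsTSR 1 (suc n) T × Good (charPoly T) →
        ∃ λ cs → Good (monicPoly cs) × toTSR cs ≡ T
      toTSR-surjective T ((c , B , T≡tsr) , good) = cs ,
        good-cong (≐-trans (≡⇒≐ (cong charPoly (sym toTSR≡T))) (charPoly-toTSR cs)) good , toTSR≡T
        where
        lastColumn : V (suc n ℕ.* 1)
        lastColumn i = lookup c (proj₁ (remQuot {suc n} 1 i)) * entry B zero zero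

        cs = tabulate (neg lastColumn)

        toTSR≡T : toTSR cs ≡ T
        toTSR≡T = trans (toMat-cong (companion-cong λ i →
            trans (cong -_ (Vec.lookup∘tabulate (neg lastColumn) i)) (-‿involutive (lastColumn i))))
          (sym (trans T≡tsr (tsr-1×n {suc n} c B)))

open import Data.Nat using (_*_; _∸_; _^_; _≤_; _<_; _⊔_)

theorem4p1 : (q : ℕ) (F : FiniteField q) (m n : ℕ) →
    1 ≤ m → 1 ≤ n → 1 < m ⊔ n →
    let open FF F in
    (∃ λ a → HasCard (TSRI 1 n) a × HasCard (𝓘 n) a) ×
    (∃ λ a → ∃ λ g → ∃ λ i →
    HasCard (TSRI m 1) a × HasCard (GL m) g × HasCard (𝓘 m) i × a * (q ^ m ∸ 1) ≡ g * i) ×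
    (∃ λ a → HasCard (TSRP 1 n) a × HasCard (𝓟 n) a) ×
    (∃ λ a → ∃ λ g → ∃ λ i →
    HasCard (TSRP m 1) a × HasCard (GL m) g × HasCard (𝓟 m) i × a * (q ^ m ∸ 1) ≡ g * i)
theorem4p1 q F m n 1≤m 1≤n _ =
  TSR-1×n Irreducible irreducible-cong (λ irr → irr) irreducible? n 1≤n ,
  TSR-m×1 Irreducible irreducible-cong (λ irr → irr) irreducible? m 1≤m ,
  TSR-1×n Primitive primitive-cong proj₁ primitive? n 1≤n ,
  TSR-m×1 Primitive primitive-cong proj₁ primitive? m 1≤m
  where
  open FF F
  open Counting F
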